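{- There is an FP+Card formula which, on square integer matrices $M$ represented as structures (as described in the context), defines "$M$ is non-singular", i.e., holds exactly when $\det M\neq 0$.
   Context: An $I$-square integer matrix $M:I\times I\to\mathbb Z$ is represented as a two-sorted structure with sorts $I$ and $\{\hat0,\hat1,\dots,\hat k\}$, with the relations: the linear ordering $\hat0<\hat1<\dots<\hat k$ on the second sort; the ternary relation $M(i,j,\hat s)$ meaning "the coefficient of $2^s$ in the binary expansion of the absolute value of the $(i,j)$ entry of $M$ is $1$"; and the binary relation "the $(i,j)$ entry of $M$ is positive". The determinant is computed after choosing any linear ordering of $I$ for both rows and columns and is independent of the choice. FP+Card: each input structure with universe $A$ is extended by a numerical sort $\{0,\dots,|A|\}$ with successor; formulas are first-order formulas extended by the inflationary fixpoint operator (on any sorts) and counting terms $(\sharp x)\varphi(x)$. -}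

module Defs where

open import Data.Nat using (ℕ; zero; suc; _+_; _*_; _^_; _<_; _≤ᵇ_; _≡ᵇ_; _<ᵇ_)
open import Data.Nat.DivMod using (_/_; _%_)
open import Data.Bool using (Bool; true; false; _∧_; _∨_; not; if_then_else_)
open import Data.Fin using (Fin; zero; suc; toℕ; fromℕ<; fromℕ; punchIn; inject≤)
open import Data.Fin.Properties using (_≟_)
open import Data.Integer as ℤ using (ℤ; +_; -[1+_]; ∣_∣)
open import Data.List using (List; []; _∷_; _++_)
open import Data.List.Membership.Propositional using (_∈_)
open import Data.List.Relation.Unary.All using (All; []; _∷_; lookup)
open import Data.List.Relation.Unary.All.Properties using (++⁺)
open import Relation.Nullary.Decidable using (⌊_⌋)

Matrix : ℕ → Set
Matrix n = Fin n → Fin n → ℤ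

sumℤ : (m : ℕ) → (Fin m → ℤ) → ℤ
sumℤ zero    f = + 0
sumℤ (suc m) f = f zero ℤ.+ sumℤ m (λ i → f (suc i))

signℤ : ℕ → ℤ
signℤ zero          = + 1
signℤ (suc zero)    = ℤ.- (+ 1)
signℤ (suc (suc j)) = signℤ j

minor : ∀ {n} → Matrix (suc n) → Fin (suc n) → Matrix n
minor M j i j' = M (suc i) (punchIn j j')

det : ∀ n → Matrix n → ℤ
det zero    M = + 1
det (suc n) M = sumℤ (suc n) (λ j → signℤ (toℕ j) ℤ.* (M zero j ℤ.* det n (minor M j)))

bitℕ : ℕ → ℕ → Bool
bitℕ m zero    = m % 2 ≡ᵇ 1
bitℕ m (suc s) = bitℕ (m / 2) s

isPos : ℤ → Bool
isPos (+ zero)  = false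
isPos (+ suc _) = true
isPos -[1+ _ ]  = false

-- a structure with index sort I = Fin n and bit sort {0̂,…,k̂} = Fin (suc k)
record MStr : Set where
  field
    n    : ℕ
    k    : ℕ
    bitR : Fin n → Fin n → Fin (suc k) → Bool
    posR : Fin n → Fin n → Bool

Fits : ∀ {n} → ℕ → Matrix n → Set
Fits {n} k M = (i j : Fin n) → ∣ M i j ∣ < 2 ^ suc k

toStr : (n k : ℕ) → Matrix n → MStr
toStr n k M = record
  { n = n ; k = k
  ; bitR = λ i j s → bitℕ ∣ M i j ∣ (toℕ s)
  ; posR = λ i j → isPos (M i j) }

-- ι = index sort I, β = bit sort, ν = numerical sort {0,…,|A|}
data Sort : Set where
  ι β ν : Sort

data StrSort : Sort → Set where
  ι : StrSort ι
  β : StrSort β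

Ctx : Set
Ctx = List Sort

-- relation-variable contexts: list of arities (tuples of sorts)
RCtx : Set
RCtx = List (List Sort)

mutual
  data Term (Γ : Ctx) (Δ : RCtx) : Sort → Set where
    var   : ∀ {s} → s ∈ Γ → Term Γ Δ s
    count : ∀ {s} → StrSort s → Formula (s ∷ Γ) Δ → Term Γ Δ ν

  data Formula (Γ : Ctx) (Δ : RCtx) : Set where
    eq   : ∀ {s} → Term Γ Δ s → Term Γ Δ s → Formula Γ Δ
    lessB : Term Γ Δ β → Term Γ Δ β → Formula Γ Δ
    succN : Term Γ Δ ν → Term Γ Δ ν → Formula Γ Δ
    bitM : Term Γ Δ ι → Term Γ Δ ι → Term Γ Δ β → Formula Γ Δ
    posM : Term Γ Δ ι → Term Γ Δ ι → Formula Γ Δ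
    rel  : ∀ {a} → a ∈ Δ → All (Term Γ Δ) a → Formula Γ Δ
    neg  : Formula Γ Δ → Formula Γ Δ
    and  : Formula Γ Δ → Formula Γ Δ → Formula Γ Δ
    or   : Formula Γ Δ → Formula Γ Δ → Formula Γ Δ
    ex   : (s : Sort) → Formula (s ∷ Γ) Δ → Formula Γ Δ
    all  : (s : Sort) → Formula (s ∷ Γ) Δ → Formula Γ Δ
    -- [ifp_{R,x̄} φ](t̄), R of arity a, x̄ the first |a| variables of the body
    ifp  : (a : List Sort) → Formula (a ++ Γ) (a ∷ Δ) → All (Term Γ Δ) a → Formula Γ Δ

Sentence : Set
Sentence = Formula [] []

anyFin : (m : ℕ) → (Fin m → Bool) → Bool
anyFin zero    f = false
anyFin (suc m) f = f zero ∨ anyFin m (λ i → f (suc i))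

allFin : (m : ℕ) → (Fin m → Bool) → Bool
allFin m f = not (anyFin m (λ i → not (f i)))

countFin : (m : ℕ) → (Fin m → Bool) → ℕ
countFin zero    f = 0
countFin (suc m) f = (if f zero then 1 else 0) + countFin m (λ i → f (suc i))

-- saturating conversion into {0,…,N} (never saturates for counting terms)
toNum : (N : ℕ) → ℕ → Fin (suc N)
toNum zero    m       = zero
toNum (suc N) zero    = zero
toNum (suc N) (suc m) = suc (toNum N m)

module Sem (𝔄 : MStr) where
  open MStr 𝔄

  card : ℕ
  card = n + suc k

  size : Sort → ℕ
  size ι = n
  size β = suc k
  size ν = suc card

  ⟦_⟧ : Sort → Set
  ⟦ s ⟧ = Fin (size s)

  Tuple : List Sort → Set
  Tuple a = All ⟦_⟧ a

  RelVal : List Sort → Set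
  RelVal a = Tuple a → Bool

  tupleCount : List Sort → ℕ
  tupleCount []      = 1
  tupleCount (s ∷ a) = size s * tupleCount a

  mutual
    evalT : ∀ {Γ Δ s} → Term Γ Δ s → All ⟦_⟧ Γ → All RelVal Δ → ⟦ s ⟧
    evalT (var x)     e ρ = lookup e x
    evalT (count {s} _ φ) e ρ =
      toNum card (countFin (size s) (λ x → eval φ (x ∷ e) ρ))

    evalTs : ∀ {Γ Δ a} → All (Term Γ Δ) a → All ⟦_⟧ Γ → All RelVal Δ → Tuple a
    evalTs []       e ρ = []
    evalTs (t ∷ ts) e ρ = evalT t e ρ ∷ evalTs ts e ρ

    stage : ∀ {Γ Δ} (a : List Sort) → Formula (a ++ Γ) (a ∷ Δ) →
            All ⟦_⟧ Γ → All RelVal Δ → ℕ → RelVal a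
    stage a φ e ρ zero    t = false
    stage a φ e ρ (suc i) t =
      stage a φ e ρ i t ∨ eval φ (++⁺ t e) (stage a φ e ρ i ∷ ρ)

    eval : ∀ {Γ Δ} → Formula Γ Δ → All ⟦_⟧ Γ → All RelVal Δ → Bool
    eval (eq t u)       e ρ = ⌊ evalT t e ρ ≟ evalT u e ρ ⌋
    eval (lessB t u)    e ρ = toℕ (evalT t e ρ) <ᵇ toℕ (evalT u e ρ)
    eval (succN t u)    e ρ = suc (toℕ (evalT t e ρ)) ≡ᵇ toℕ (evalT u e ρ)
    eval (bitM i j s)   e ρ = bitR (evalT i e ρ) (evalT j e ρ) (evalT s e ρ)
    eval (posM i j)     e ρ = posR (evalT i e ρ) (evalT j e ρ)
    eval (rel r ts)     e ρ = lookup ρ r (evalTs ts e ρ)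
    eval (neg φ)        e ρ = not (eval φ e ρ)
    eval (and φ ψ)      e ρ = eval φ e ρ ∧ eval ψ e ρ
    eval (or φ ψ)       e ρ = eval φ e ρ ∨ eval ψ e ρ
    eval (ex s φ)       e ρ = anyFin (size s) (λ x → eval φ (x ∷ e) ρ)
    eval (all s φ)      e ρ = allFin (size s) (λ x → eval φ (x ∷ e) ρ)
    -- the number of tuples bounds the number of strict increases,
    -- so the stage tupleCount a is the inflationary fixpoint
    eval (ifp a φ ts)   e ρ = stage a φ e ρ (tupleCount a) (evalTs ts e ρ)

_⊨_ : MStr → Sentence → Bool
𝔄 ⊨ φ = Sem.eval 𝔄 φ [] []

{-# OPTIONS --safe #-}

-- For M : I × I → ℤ with |I| = n put X₀ = 1, P_t = M X_t and X_{t+1} = tr(P_t) 1 - (t + 1) P_t: the Faddeev-LeVerrier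
-- recursion with its denominators cleared. Laplace expansion along the first row gives
--   P_t(x, y) = Σ_{i ∈ I^t} det (M with rows x, i₁, …, i_t and columns y, i₁, …, i_t).
-- For t = n - 1 and x = y each summand is 0 (a repeated index) or det M (a simultaneous permutation of rows and
-- columns), and one of them is det M; so det M ≠ 0 iff some P_{n-1}(x, x) is nonzero. The recursion is invariant
-- under permutations of I, and |P_{n-1}(x, y)| < 2 ^ N², where N is the size of the numerical sort. It is therefore
-- carried out on integers modulo 2 ^ N², whose binary digits are indexed by pairs of numbers. Addition of such
-- integers is first-order (carry lookahead), sums over the unordered set I count, at each position, the digits 1,
-- and loops are inflationary fixed points.

module Submission where

open import Defs
open import Data.Nat as ℕ using (ℕ; zero; suc; z≤n; s≤s; _^_; _∸_; _⊓_)
open import Data.Nat.DivMod using (_/_; _%_; m≡m%n+[m/n]*n; m<n*o⇒m/o<n; m%n<n)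
import Data.Nat.Properties as ℕ
import Data.Nat.Tactic.RingSolver as ℕRing
open import Data.Bool using (Bool; true; false; _∧_; _∨_; not; _xor_; if_then_else_)
open import Data.Bool.Properties using (T-≡; ∨-identityʳ)
open import Data.Fin using (Fin; zero; suc; toℕ; fromℕ<; punchIn; punchOut; inject₁; combine; quotient; remainder)
open import Data.Fin.Properties using (_≟_; <-cmp; <⇒≢; any?; pigeonhole; toℕ<n; toℕ-fromℕ<; toℕ-injective; toℕ-inject₁; punchOut-punchIn; punchInᵢ≢i; punchIn-punchOut; punchOut-cong; punchOut-injective; remQuot-combine; combine-remQuot; combine-monoˡ-<; toℕ-combine)
open import Data.Fin.Induction using (<-weakInduction)
open import Data.Integer using (ℤ; +_; -[1+_]; _+_; _*_; -_; _-_; ∣_∣)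
open import Data.Integer.Properties as ℤ using (+-identityˡ; +-identityʳ; *-identityˡ; *-zeroʳ; *-zeroˡ; *-distribˡ-+; *-distribʳ-+; neg-distrib-+; i*j≡0⇒i≡0∨j≡0; +-injective)
open import Data.Integer.Tactic.RingSolver using (solve-∀)
open import Data.List using (List; []; _∷_; _++_)
open import Data.List.Membership.Propositional using (_∈_)
open import Data.List.Relation.Unary.All using (All; []; _∷_; lookup)
open import Data.List.Relation.Unary.All.Properties using (++⁺)
open import Data.List.Relation.Unary.Any using (here; there)
open import Data.Vec as Vec using (Vec; []; _∷_; insertAt; tabulate)
open import Data.Vec.Properties using (insertAt-lookup; insertAt-punchIn; lookup∘tabulate)
open import Data.Product using (Σ; ∃; _×_; _,_; proj₁; proj₂)
open import Data.Sum using (_⊎_; inj₁; inj₂; [_,_]′)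
open import Data.Empty using (⊥-elim)
open import Function using (_∘_; Equivalence)
open import Relation.Nullary using (Dec; yes; no; ¬_)
open import Relation.Nullary.Decidable using (⌊_⌋)
open import Relation.Binary.Definitions using (tri<; tri≈; tri>)
open import Relation.Binary.PropositionalEquality

open ≡-Reasoning

-- Determinants

-- Gaussian elimination chooses pivots and so needs an order on `I`, which the structure does not
-- provide; the recursion uses only products, traces and scalars. The classical recursion divides by
-- t in each round; without the divisions the formula is spared a long division, and X_t is t! times
-- the classical matrix up to sign. An entry may need on the order of n (n + k) digits, more than
-- the numerical sort has elements; this is why a position is a pair. Residues modulo a power of 2
-- are signed numbers in two's complement: subtraction needs no case distinction, and intermediate
-- values may overflow, since only the final value has to be small. An inflationary fixed point
-- never withdraws a tuple, whereas the digits of a loop state change from round to round. Hence the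
-- states of all rounds are kept side by side, indexed by time, and marks tell a digit 0 from a
-- digit that is not computed yet.

sum-cong : ∀ m {f g : Fin m → ℤ} → (∀ i → f i ≡ g i) → sumℤ m f ≡ sumℤ m g
sum-cong zero    h = refl
sum-cong (suc m) h = cong₂ _+_ (h zero) (sum-cong m (h ∘ suc))

sum-0 : ∀ m → sumℤ m (λ _ → + 0) ≡ + 0
sum-0 zero    = refl
sum-0 (suc m) = trans (+-identityˡ _) (sum-0 m)

sum-+ : ∀ m (f g : Fin m → ℤ) → sumℤ m (λ i → f i + g i) ≡ sumℤ m f + sumℤ m g
sum-+ zero    f g = refl
sum-+ (suc m) f g = trans (cong (_+_ (f zero + g zero)) (sum-+ m (f ∘ suc) (g ∘ suc))) (shuffle (f zero) (g zero) _ _)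
  where
  shuffle : ∀ a b c d → (a + b) + (c + d) ≡ (a + c) + (b + d)
  shuffle = solve-∀

sum-*ˡ : ∀ m c (f : Fin m → ℤ) → sumℤ m (λ i → c * f i) ≡ c * sumℤ m f
sum-*ˡ zero    c f = sym (*-zeroʳ c)
sum-*ˡ (suc m) c f = trans (cong (_+_ (c * f zero)) (sum-*ˡ m c (f ∘ suc))) (sym (*-distribˡ-+ c (f zero) _))

sum-neg : ∀ m (f : Fin m → ℤ) → sumℤ m (λ i → - f i) ≡ - sumℤ m f
sum-neg zero    f = refl
sum-neg (suc m) f = trans (cong (_+_ (- f zero)) (sum-neg m (f ∘ suc))) (sym (neg-distrib-+ (f zero) _))

sum-const : ∀ m c → sumℤ m (λ _ → c) ≡ + m * c
sum-const zero    c = sym (*-zeroˡ c)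
sum-const (suc m) c = trans (cong (_+_ c) (sum-const m c)) (step (+ m) c)
  where
  step : ∀ a c → c + a * c ≡ (+ 1 + a) * c
  step = solve-∀

sum-swap : ∀ m p (f : Fin m → Fin p → ℤ) →
  sumℤ m (λ i → sumℤ p (λ j → f i j)) ≡ sumℤ p (λ j → sumℤ m (λ i → f i j))
sum-swap zero    p f = sym (sum-0 p)
sum-swap (suc m) p f = trans (cong (_+_ (sumℤ p (f zero))) (sum-swap m p (f ∘ suc)))
                             (sym (sum-+ p (f zero) (λ j → sumℤ m (λ i → f (suc i) j))))

sum-punchIn : ∀ {m} (j : Fin (suc m)) (f : Fin (suc m) → ℤ) →
  sumℤ (suc m) f ≡ f j + sumℤ m (f ∘ punchIn j)
sum-punchIn zero f = refl
sum-punchIn {suc m} (suc j) f =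
  trans (cong (_+_ (f zero)) (sum-punchIn j (f ∘ suc))) (rotate (f zero) (f (suc j)) _)
  where
  rotate : ∀ a b c → a + (b + c) ≡ b + (a + c)
  rotate = solve-∀

sign-suc : ∀ m → signℤ (suc m) ≡ - signℤ m
sign-suc zero          = refl
sign-suc (suc zero)    = refl
sign-suc (suc (suc m)) = sign-suc m

sign-square : ∀ m → signℤ m * signℤ m ≡ + 1
sign-square zero          = refl
sign-square (suc zero)    = refl
sign-square (suc (suc m)) = sign-square m

det-cong : ∀ n {A B : Matrix n} → (∀ i j → A i j ≡ B i j) → det n A ≡ det n B
det-cong zero    h = refl
det-cong (suc n) h = sum-cong (suc n) λ j →
  cong (signℤ (toℕ j) *_) (cong₂ _*_ (h zero j) (det-cong n (λ i l → h (suc i) (punchIn j l))))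

-- Antisymmetry under adjacent transpositions

adj : ∀ {n} → Fin n → Fin (suc n) → Fin (suc n)
adj zero    zero          = suc zero
adj zero    (suc zero)    = zero
adj zero    (suc (suc j)) = suc (suc j)
adj (suc a) zero          = zero
adj (suc a) (suc j)       = suc (adj a j)

adj-involutive : ∀ {n} (a : Fin n) j → adj a (adj a j) ≡ j
adj-involutive zero    zero          = refl
adj-involutive zero    (suc zero)    = refl
adj-involutive zero    (suc (suc j)) = refl
adj-involutive (suc a) zero          = refl
adj-involutive (suc a) (suc j)       = cong suc (adj-involutive a j)

sum-adj : ∀ {n} (a : Fin n) (f : Fin (suc n) → ℤ) → sumℤ (suc n) (f ∘ adj a) ≡ sumℤ (suc n) f
sum-adj zero    f = rotate (f (suc zero)) (f zero) _
  where
  rotate : ∀ a b c → a + (b + c) ≡ b + (a + c)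
  rotate = solve-∀
sum-adj (suc a) f = cong (_+_ (f zero)) (sum-adj a (f ∘ suc))

-- The two cases of the Laplace expansion. A column outside the transposed pair stays in place, and
-- the transposition acts on its minor as an adjacent one. For a column of the pair the minor is the
-- same as before, and only the sign of its position changes.
adj-punchIn : ∀ {n} (a : Fin (suc n)) (j : Fin (suc (suc n))) →
  (adj a j ≡ j × Σ (Fin n) λ a' → ∀ l → adj a (punchIn j l) ≡ punchIn j (adj a' l))
  ⊎ (signℤ (toℕ (adj a j)) ≡ - signℤ (toℕ j) × (∀ l → adj a (punchIn (adj a j) l) ≡ punchIn j l))
adj-punchIn zero zero       = inj₂ (refl , λ { zero → refl ; (suc l) → refl })
adj-punchIn zero (suc zero) = inj₂ (refl , λ { zero → refl ; (suc l) → refl })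
adj-punchIn {suc n} zero (suc (suc j)) =
  inj₁ (refl , zero , λ { zero → refl ; (suc zero) → refl ; (suc (suc l)) → refl })
adj-punchIn {suc n} (suc a) zero = inj₁ (refl , a , λ l → refl)
adj-punchIn {suc n} (suc a) (suc j) with adj-punchIn a j
... | inj₁ (fix , a' , h) = inj₁ (cong suc fix , suc a' , λ { zero → refl ; (suc l) → cong suc (h l) })
... | inj₂ (sgn , h) = inj₂
  ( trans (sign-suc (toℕ (adj a j))) (cong -_ (trans sgn (sym (sign-suc (toℕ j)))))
  , λ { zero → refl ; (suc l) → cong suc (h l) })

-- Once the sum is reindexed by the transposition itself, the identity holds term by term: the minus
-- sign comes from the minor or from the position of the column.
det-col-adj : ∀ {n} (a : Fin n) (A : Matrix (suc n)) →
  det (suc n) (λ i j → A i (adj a j)) ≡ - det (suc n) A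
det-col-adj {suc n} a A = begin
  sumℤ (2 ℕ.+ n) term'            ≡⟨ sum-adj a term' ⟨
  sumℤ (2 ℕ.+ n) (term' ∘ adj a)  ≡⟨ sum-cong (2 ℕ.+ n) negated ⟩
  sumℤ (2 ℕ.+ n) (λ j → - term j) ≡⟨ sum-neg (2 ℕ.+ n) term ⟩
  - sumℤ (2 ℕ.+ n) term           ∎
  where
  A' : Matrix (2 ℕ.+ n)
  A' i j = A i (adj a j)
  term term' : Fin (2 ℕ.+ n) → ℤ
  term  j = signℤ (toℕ j) * (A zero j * det (suc n) (minor A j))
  term' j = signℤ (toℕ j) * (A zero (adj a j) * det (suc n) (minor A' j))
  neg-in : ∀ s x d → s * (x * - d) ≡ - (s * (x * d))
  neg-in = solve-∀
  neg-out : ∀ s x d → (- s) * (x * d) ≡ - (s * (x * d))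
  neg-out = solve-∀
  negated : ∀ j → term' (adj a j) ≡ - term j
  negated j with adj-punchIn a j
  ... | inj₁ (fix , a' , h) = begin
    term' (adj a j)   ≡⟨ cong term' fix ⟩
    term' j           ≡⟨ cong₂ (λ u v → signℤ (toℕ j) * (A zero u * v)) fix
                           (trans (det-cong (suc n) (λ i l → cong (A (suc i)) (h l))) (det-col-adj a' (minor A j))) ⟩
    signℤ (toℕ j) * (A zero j * - det (suc n) (minor A j)) ≡⟨ neg-in (signℤ (toℕ j)) (A zero j) _ ⟩
    - term j ∎
  ... | inj₂ (sgn , h) = begin
    term' (adj a j)   ≡⟨ cong₂ _*_ sgn (cong₂ _*_ (cong (A zero) (adj-involutive a j))
                           (det-cong (suc n) (λ i l → cong (A (suc i)) (h l)))) ⟩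
    (- signℤ (toℕ j)) * (A zero j * det (suc n) (minor A j)) ≡⟨ neg-out (signℤ (toℕ j)) (A zero j) _ ⟩
    - term j ∎

-- Deleting a column shifts the columns to its right by one, so exactly one of the two orders of
-- deleting `i` and `v` lowers the second position by one.
punchOut-sign : ∀ {n} (i v : Fin (suc n)) (i≢v : i ≢ v) (v≢i : v ≢ i) →
  signℤ (toℕ i) * signℤ (toℕ (punchOut i≢v)) ≡ - (signℤ (toℕ v) * signℤ (toℕ (punchOut v≢i)))
punchOut-sign zero zero p q = ⊥-elim (p refl)
punchOut-sign {suc n} zero (suc v) p q = trans (lem (signℤ (toℕ v))) (cong (λ z → - (z * + 1)) (sym (sign-suc (toℕ v))))
  where
  lem : ∀ s → + 1 * s ≡ - ((- s) * + 1)
  lem = solve-∀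
punchOut-sign {suc n} (suc i) zero p q = trans (cong (_* + 1) (sign-suc (toℕ i))) (lem (signℤ (toℕ i)))
  where
  lem : ∀ s → (- s) * + 1 ≡ - (+ 1 * s)
  lem = solve-∀
punchOut-sign {suc n} (suc i) (suc v) p q = begin
  signℤ (suc (toℕ i)) * signℤ (suc (toℕ o))   ≡⟨ cong₂ _*_ (sign-suc (toℕ i)) (sign-suc (toℕ o)) ⟩
  (- signℤ (toℕ i)) * (- signℤ (toℕ o))       ≡⟨ neg² (signℤ (toℕ i)) _ ⟩
  signℤ (toℕ i) * signℤ (toℕ o)               ≡⟨ punchOut-sign i v (p ∘ cong suc) (q ∘ cong suc) ⟩
  - (signℤ (toℕ v) * signℤ (toℕ o'))          ≡⟨ cong -_ (neg² (signℤ (toℕ v)) _) ⟨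
  - ((- signℤ (toℕ v)) * (- signℤ (toℕ o')))  ≡⟨ cong -_ (cong₂ _*_ (sign-suc (toℕ v)) (sign-suc (toℕ o'))) ⟨
  - (signℤ (suc (toℕ v)) * signℤ (suc (toℕ o'))) ∎
  where
  o = punchOut {i = i} {j = v} (p ∘ cong suc)
  o' = punchOut {i = v} {j = i} (q ∘ cong suc)
  neg² : ∀ a b → (- a) * (- b) ≡ a * b
  neg² = solve-∀

-- Both sides enumerate the columns other than `i` and `v` in increasing order.
punchIn-punchOut-comm : ∀ {n} (i v : Fin (suc (suc n))) (i≢v : i ≢ v) (v≢i : v ≢ i) l →
  punchIn i (punchIn (punchOut i≢v) l) ≡ punchIn v (punchIn (punchOut v≢i) l)
punchIn-punchOut-comm zero zero p q l = ⊥-elim (p refl)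
punchIn-punchOut-comm zero (suc v) p q l = refl
punchIn-punchOut-comm (suc i) zero p q l = refl
punchIn-punchOut-comm {suc n} (suc i) (suc v) p q zero = refl
punchIn-punchOut-comm {suc n} (suc i) (suc v) p q (suc l) =
  cong suc (punchIn-punchOut-comm i v (p ∘ cong suc) (q ∘ cong suc) l)

-- The Laplace expansion along two rows a, b is a bilinear form in a and b with antisymmetric coefficients.
module TwoRows {n : ℕ} (A : Fin n → Fin (suc (suc n)) → ℤ) where

  rest : Fin (suc (suc n)) → Fin (suc n) → ℤ
  rest j j' = det n (λ i l → A i (punchIn j (punchIn j' l)))

  expand : (a b : Fin (suc (suc n)) → ℤ) → ℤ
  expand a b = sumℤ (2 ℕ.+ n) λ j → signℤ (toℕ j) *
    (a j * sumℤ (suc n) λ j' → signℤ (toℕ j') * (b (punchIn j j') * rest j j'))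

  -- The value 0 on the diagonal turns the sum over distinct columns into a sum over all pairs, in
  -- which the two indices can be interchanged.
  coeff : (j v : Fin (suc (suc n))) → ℤ
  coeff j v with j ≟ v
  ... | yes _ = + 0
  ... | no ne = signℤ (toℕ j) * signℤ (toℕ (punchOut ne)) * rest j (punchOut ne)

  coeff-diag : ∀ j → coeff j j ≡ + 0
  coeff-diag j with j ≟ j
  ... | yes _ = refl
  ... | no ne = ⊥-elim (ne refl)

  coeff-antisym : ∀ j v → coeff v j ≡ - coeff j v
  coeff-antisym j v with j ≟ v | v ≟ j
  ... | yes _ | yes _ = refl
  ... | yes e | no ne = ⊥-elim (ne (sym e))
  ... | no ne | yes e = ⊥-elim (ne (sym e))
  ... | no p  | no q  = begin
    signℤ (toℕ v) * signℤ (toℕ (punchOut q)) * rest v (punchOut q)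
      ≡⟨ cong₂ _*_ (punchOut-sign v j q p) (det-cong n (λ i l → cong (A i) (punchIn-punchOut-comm v j q p l))) ⟩
    - (signℤ (toℕ j) * signℤ (toℕ (punchOut p))) * rest j (punchOut p)
      ≡⟨ neg-out (signℤ (toℕ j) * signℤ (toℕ (punchOut p))) _ ⟩
    - (signℤ (toℕ j) * signℤ (toℕ (punchOut p)) * rest j (punchOut p)) ∎
    where
    neg-out : ∀ x y → (- x) * y ≡ - (x * y)
    neg-out = solve-∀

  coeff-punchIn : ∀ j j' → coeff j (punchIn j j') ≡ signℤ (toℕ j) * signℤ (toℕ j') * rest j j'
  coeff-punchIn j j' with j ≟ punchIn j j'
  ... | yes e = ⊥-elim (punchInᵢ≢i j j' (sym e))
  ... | no ne = cong (λ z → signℤ (toℕ j) * signℤ (toℕ z) * rest j z)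
                  (trans (punchOut-cong j refl) (punchOut-punchIn j))

  expand-coeff : ∀ a b → expand a b ≡ sumℤ (2 ℕ.+ n) λ j → sumℤ (2 ℕ.+ n) λ v → a j * b v * coeff j v
  expand-coeff a b = sum-cong (2 ℕ.+ n) λ j → sym (begin
    sumℤ (2 ℕ.+ n) (λ v → a j * b v * coeff j v)
      ≡⟨ sum-punchIn j (λ v → a j * b v * coeff j v) ⟩
    a j * b j * coeff j j + sumℤ (suc n) (λ j' → a j * b (punchIn j j') * coeff j (punchIn j j'))
      ≡⟨ cong₂ _+_ (trans (cong (a j * b j *_) (coeff-diag j)) (*-zeroʳ (a j * b j)))
           (sum-cong (suc n) λ j' → trans (cong (a j * b (punchIn j j') *_) (coeff-punchIn j j'))
              (regroup (a j) (b (punchIn j j')) (signℤ (toℕ j)) (signℤ (toℕ j')) (rest j j'))) ⟩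
    + 0 + sumℤ (suc n) (λ j' → (signℤ (toℕ j) * a j) * inner j j')
      ≡⟨ +-identityˡ _ ⟩
    sumℤ (suc n) (λ j' → (signℤ (toℕ j) * a j) * inner j j')
      ≡⟨ sum-*ˡ (suc n) (signℤ (toℕ j) * a j) (inner j) ⟩
    (signℤ (toℕ j) * a j) * sumℤ (suc n) (inner j)
      ≡⟨ assoc (signℤ (toℕ j)) (a j) _ ⟩
    signℤ (toℕ j) * (a j * sumℤ (suc n) (inner j)) ∎)
    where
    inner : ∀ j j' → ℤ
    inner j j' = signℤ (toℕ j') * (b (punchIn j j') * rest j j')
    regroup : ∀ x y s t r → x * y * (s * t * r) ≡ (s * x) * (t * (y * r))
    regroup = solve-∀
    assoc : ∀ x y z → (x * y) * z ≡ x * (y * z)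
    assoc = solve-∀

  expand-antisym : ∀ a b → expand b a ≡ - expand a b
  expand-antisym a b = begin
    expand b a
      ≡⟨ expand-coeff b a ⟩
    sumℤ (2 ℕ.+ n) (λ j → sumℤ (2 ℕ.+ n) λ v → b j * a v * coeff j v)
      ≡⟨ sum-swap (2 ℕ.+ n) (2 ℕ.+ n) (λ j v → b j * a v * coeff j v) ⟩
    sumℤ (2 ℕ.+ n) (λ v → sumℤ (2 ℕ.+ n) λ j → b j * a v * coeff j v)
      ≡⟨ sum-cong (2 ℕ.+ n) (λ v → trans (sum-cong (2 ℕ.+ n) (λ j →
           trans (cong (b j * a v *_) (coeff-antisym v j)) (flip (a v) (b j) (coeff v j))))
           (sum-neg (2 ℕ.+ n) (λ j → a v * b j * coeff v j))) ⟩
    sumℤ (2 ℕ.+ n) (λ v → - sumℤ (2 ℕ.+ n) λ j → a v * b j * coeff v j)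
      ≡⟨ sum-neg (2 ℕ.+ n) (λ v → sumℤ (2 ℕ.+ n) λ j → a v * b j * coeff v j) ⟩
    - sumℤ (2 ℕ.+ n) (λ v → sumℤ (2 ℕ.+ n) λ j → a v * b j * coeff v j)
      ≡⟨ cong -_ (expand-coeff a b) ⟨
    - expand a b ∎
    where
    flip : ∀ x y c → y * x * (- c) ≡ - (x * y * c)
    flip = solve-∀

-- Two steps of the Laplace expansion unfold to `TwoRows.expand` by definition, which settles the
-- first two rows. Any other pair of adjacent rows is swapped inside the minors.
det-row-adj : ∀ {n} (a : Fin n) (A : Matrix (suc n)) →
  det (suc n) (λ i j → A (adj a i) j) ≡ - det (suc n) A
det-row-adj {suc n} zero A =
  TwoRows.expand-antisym (λ i j → A (suc (suc i)) j) (A zero) (A (suc zero))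
det-row-adj {suc n} (suc a) A = trans
  (sum-cong (2 ℕ.+ n) λ j → trans
    (cong (λ z → signℤ (toℕ j) * (A zero j * z)) (det-row-adj a (minor A j)))
    (neg-in (signℤ (toℕ j)) (A zero j) _))
  (sum-neg (2 ℕ.+ n) λ j → signℤ (toℕ j) * (A zero j * det (suc n) (minor A j)))
  where
  neg-in : ∀ s x d → s * (x * - d) ≡ - (s * (x * d))
  neg-in = solve-∀

-- Moving an index to the front

toFront : ∀ {n} → Fin (suc n) → Fin (suc n) → Fin (suc n)
toFront b zero    = b
toFront b (suc j) = punchIn b j

-- By this recursion `toFront b` is a product of b adjacent transpositions, hence a cycle of sign
-- (-1)^b.
toFront-suc : ∀ {n} (b : Fin n) j → toFront (suc b) j ≡ adj b (toFront (inject₁ b) j)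
toFront-suc b zero = lem b
  where
  lem : ∀ {n} (b : Fin n) → suc b ≡ adj b (inject₁ b)
  lem zero = refl
  lem (suc b) = cong suc (lem b)
toFront-suc b (suc j) = lem b j
  where
  lem : ∀ {n} (b j : Fin n) → punchIn (suc b) j ≡ adj b (punchIn (inject₁ b) j)
  lem zero    zero    = refl
  lem zero    (suc j) = refl
  lem (suc b) zero    = refl
  lem (suc b) (suc j) = cong suc (lem b j)

-- `V` is a function of a whole enumeration of rows or of columns, so that one induction serves
-- both.
module Alternating {n : ℕ} {X : Set} (V : (Fin (suc n) → X) → ℤ)
  (V-cong : ∀ {f g} → (∀ i → f i ≡ g i) → V f ≡ V g)
  (V-adj : ∀ (a : Fin n) f → V (f ∘ adj a) ≡ - V f) where

  V-toFront : ∀ b f → V (f ∘ toFront b) ≡ signℤ (toℕ b) * V f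
  V-toFront = <-weakInduction (λ b → ∀ f → V (f ∘ toFront b) ≡ signℤ (toℕ b) * V f) base step
    where
    base : ∀ f → V (f ∘ toFront zero) ≡ + 1 * V f
    base f = trans (V-cong (λ { zero → refl ; (suc i) → refl })) (sym (*-identityˡ _))
    step : ∀ b → (∀ f → V (f ∘ toFront (inject₁ b)) ≡ signℤ (toℕ (inject₁ b)) * V f) →
           ∀ f → V (f ∘ toFront (suc b)) ≡ signℤ (suc (toℕ b)) * V f
    step b ih f = begin
      V (f ∘ toFront (suc b))                    ≡⟨ V-cong (λ j → cong f (toFront-suc b j)) ⟩
      V ((f ∘ adj b) ∘ toFront (inject₁ b))      ≡⟨ ih (f ∘ adj b) ⟩
      signℤ (toℕ (inject₁ b)) * V (f ∘ adj b)    ≡⟨ cong₂ (λ u v → signℤ u * v) (toℕ-inject₁ b) (V-adj b f) ⟩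
      signℤ (toℕ b) * - V f                      ≡⟨ neg-move (signℤ (toℕ b)) (V f) ⟩
      (- signℤ (toℕ b)) * V f                    ≡⟨ cong (_* V f) (sign-suc (toℕ b)) ⟨
      signℤ (suc (toℕ b)) * V f                  ∎
      where
      neg-move : ∀ s x → s * - x ≡ (- s) * x
      neg-move = solve-∀

det-row-toFront : ∀ {n} (b : Fin (suc n)) (A : Matrix (suc n)) →
  det (suc n) (λ i j → A (toFront b i) j) ≡ signℤ (toℕ b) * det (suc n) A
det-row-toFront b A = Alternating.V-toFront (λ f → det _ (λ i j → A (f i) j))
  (λ h → det-cong _ (λ i j → cong (λ z → A z j) (h i)))
  (λ a f → det-row-adj a (λ i j → A (f i) j)) b (λ i → i)

det-col-toFront : ∀ {n} (b : Fin (suc n)) (A : Matrix (suc n)) →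
  det (suc n) (λ i j → A i (toFront b j)) ≡ signℤ (toℕ b) * det (suc n) A
det-col-toFront b A = Alternating.V-toFront (λ f → det _ (λ i j → A i (f j)))
  (λ h → det-cong _ (λ i j → cong (A i) (h j)))
  (λ a f → det-col-adj a (λ i j → A i (f j))) b (λ i → i)

det-toFront : ∀ {n} (b : Fin (suc n)) (A : Matrix (suc n)) →
  det (suc n) (λ i j → A (toFront b i) (toFront b j)) ≡ det (suc n) A
det-toFront {n} b A = begin
  det (suc n) (λ i j → A (toFront b i) (toFront b j)) ≡⟨ det-row-toFront b (λ i j → A i (toFront b j)) ⟩
  s * det (suc n) (λ i j → A i (toFront b j))         ≡⟨ cong (s *_) (det-col-toFront b A) ⟩
  s * (s * det (suc n) A)                             ≡⟨ assoc s s _ ⟩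
  (s * s) * det (suc n) A                             ≡⟨ cong (_* det (suc n) A) (sign-square (toℕ b)) ⟩
  + 1 * det (suc n) A                                 ≡⟨ *-identityˡ _ ⟩
  det (suc n) A                                       ∎
  where
  s = signℤ (toℕ b)
  assoc : ∀ x y z → x * (y * z) ≡ (x * y) * z
  assoc = solve-∀

self-neg⇒0 : ∀ {x} → x ≡ - x → x ≡ + 0
self-neg⇒0 {+ zero}    e = refl
self-neg⇒0 {+ (suc n)} ()
self-neg⇒0 { -[1+ n ]} ()

det-equal-rows : ∀ {n} (A : Matrix (suc (suc n))) → (∀ j → A zero j ≡ A (suc zero) j) → det (suc (suc n)) A ≡ + 0
det-equal-rows {n} A h = self-neg⇒0 (trans (det-cong (suc (suc n)) {A} {λ i → A (adj zero i)} same) (det-row-adj zero A))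
  where
  same : ∀ i j → A i j ≡ A (adj zero i) j
  same zero          j = h j
  same (suc zero)    j = sym (h j)
  same (suc (suc i)) j = refl

-- Sums of principal minors over all tuples of indices

sumT : ∀ {n} k → (Vec (Fin n) k → ℤ) → ℤ
sumT zero    F = F []
sumT {n} (suc k) F = sumℤ n λ x → sumT k (λ v → F (x ∷ v))

sumT-cong : ∀ {n} k {F G : Vec (Fin n) k → ℤ} → (∀ v → F v ≡ G v) → sumT k F ≡ sumT k G
sumT-cong zero    h = h []
sumT-cong {n} (suc k) h = sum-cong n λ x → sumT-cong k (λ v → h (x ∷ v))

sumT-+ : ∀ {n} k (F G : Vec (Fin n) k → ℤ) → sumT k (λ v → F v + G v) ≡ sumT k F + sumT k G
sumT-+ zero    F G = refl
sumT-+ {n} (suc k) F G = trans (sum-cong n λ x → sumT-+ k (λ v → F (x ∷ v)) (λ v → G (x ∷ v)))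
  (sum-+ n (λ x → sumT k (λ v → F (x ∷ v))) (λ x → sumT k (λ v → G (x ∷ v))))

sumT-*ˡ : ∀ {n} k c (F : Vec (Fin n) k → ℤ) → sumT k (λ v → c * F v) ≡ c * sumT k F
sumT-*ˡ zero    c F = refl
sumT-*ˡ {n} (suc k) c F = trans (sum-cong n λ x → sumT-*ˡ k c (λ v → F (x ∷ v)))
  (sum-*ˡ n c (λ x → sumT k (λ v → F (x ∷ v))))

sumT-sum : ∀ {n} k m (F : Fin m → Vec (Fin n) k → ℤ) →
  sumT k (λ v → sumℤ m (λ b → F b v)) ≡ sumℤ m (λ b → sumT k (F b))
sumT-sum zero    m F = refl
sumT-sum {n} (suc k) m F = trans (sum-cong n λ x → sumT-sum k m (λ b v → F b (x ∷ v)))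
  (sum-swap n m (λ x b → sumT k (λ v → F b (x ∷ v))))

-- Any coordinate of the tuple can be summed first. In `bordered-suc` it is the coordinate whose
-- column the expansion along the border row selects.
sumT-insertAt : ∀ {n} k (b : Fin (suc k)) (F : Vec (Fin n) (suc k) → ℤ) →
  sumT (suc k) F ≡ sumℤ n (λ z → sumT k (λ w → F (insertAt w b z)))
sumT-insertAt k zero F = refl
sumT-insertAt {n} (suc k) (suc b) F = trans
  (sum-cong n λ x → sumT-insertAt k b (λ v → F (x ∷ v)))
  (sum-swap n n (λ x z → sumT k (λ w → F (x ∷ insertAt w b z))))

sub : ∀ {n k} → Matrix n → Vec (Fin n) k → Vec (Fin n) k → Matrix k
sub M u v a b = M (Vec.lookup u a) (Vec.lookup v b)

module Leverrier {n : ℕ} (M : Matrix n) where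

  -- A tuple with a repetition contributes 0 and a set of t indices is enumerated t! times, so this
  -- is t! times the t-th elementary symmetric function of the eigenvalues.
  principal : ℕ → ℤ
  principal t = sumT t (λ v → det t (sub M v v))

  bordered : ℕ → Matrix n
  bordered t x y = sumT t (λ v → det (suc t) (sub M (x ∷ v) (y ∷ v)))

  -- Expansion along the row x; the sign of moving row b to the front cancels the sign of column b + 1 up to a minus.
  bordered-expand : ∀ t x y (b : Fin (suc t)) z (w : Vec (Fin n) t) →
    signℤ (suc (toℕ b)) * (M x (Vec.lookup (insertAt w b z) b) *
      det (suc t) (minor (sub M (x ∷ insertAt w b z) (y ∷ insertAt w b z)) (suc b)))
    ≡ (- M x z) * det (suc t) (sub M (z ∷ w) (y ∷ w))
  bordered-expand t x y b z w = begin
    signℤ (suc (toℕ b)) * (M x (Vec.lookup v b) * det (suc t) A)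
      ≡⟨ cong₂ (λ s c → s * (M x c * det (suc t) A)) (sign-suc (toℕ b)) (insertAt-lookup w b z) ⟩
    (- signℤ (toℕ b)) * (M x z * det (suc t) A)
      ≡⟨ regroup (signℤ (toℕ b)) (M x z) _ ⟩
    (- M x z) * (signℤ (toℕ b) * det (suc t) A)
      ≡⟨ cong (- M x z *_) (det-row-toFront b A) ⟨
    (- M x z) * det (suc t) (λ i j → A (toFront b i) j)
      ≡⟨ cong (- M x z *_) (det-cong (suc t) (λ i j → cong₂ M (rows i) (cols j))) ⟩
    (- M x z) * det (suc t) (sub M (z ∷ w) (y ∷ w)) ∎
    where
    v = insertAt w b z
    A = minor (sub M (x ∷ v) (y ∷ v)) (suc b)
    rows : ∀ i → Vec.lookup v (toFront b i) ≡ Vec.lookup (z ∷ w) i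
    rows zero    = insertAt-lookup w b z
    rows (suc i) = insertAt-punchIn w b z i
    cols : ∀ j → Vec.lookup (y ∷ v) (punchIn (suc b) j) ≡ Vec.lookup (y ∷ w) j
    cols zero    = refl
    cols (suc j) = insertAt-punchIn w b z j
    regroup : ∀ s m d → (- s) * (m * d) ≡ (- m) * (s * d)
    regroup = solve-∀

  -- In the expansion along the border row `x`, column `y` leaves a principal minor. Each of the
  -- other t + 1 columns leaves a bordered minor whose border row is the selected index z, and by
  -- symmetry of the sum over tuples all these columns contribute the same.
  bordered-suc : ∀ t x y → bordered (suc t) x y ≡
    M x y * principal (suc t) - + suc t * sumℤ n (λ z → M x z * bordered t z y)
  bordered-suc t x y = begin
    sumT (suc t) (λ v → + 1 * (M x y * det (suc t) (sub M v v)) + sumℤ (suc t) (λ b → term b v))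
      ≡⟨ sumT-+ (suc t) (λ v → + 1 * (M x y * det (suc t) (sub M v v))) (λ v → sumℤ (suc t) (λ b → term b v)) ⟩
    sumT (suc t) (λ v → + 1 * (M x y * det (suc t) (sub M v v))) + sumT (suc t) (λ v → sumℤ (suc t) (λ b → term b v))
      ≡⟨ cong₂ _+_
           (trans (sumT-cong (suc t) (λ v → *-identityˡ (M x y * det (suc t) (sub M v v))))
                  (sumT-*ˡ (suc t) (M x y) (λ v → det (suc t) (sub M v v))))
           (sumT-sum (suc t) (suc t) term) ⟩
    M x y * principal (suc t) + sumℤ (suc t) (λ b → sumT (suc t) (term b))
      ≡⟨ cong (_+_ (M x y * principal (suc t))) (trans (sum-cong (suc t) each) (sum-const (suc t) _)) ⟩
    M x y * principal (suc t) + + suc t * (- S)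
      ≡⟨ cong (_+_ (M x y * principal (suc t))) (neg-in (+ suc t) S) ⟩
    M x y * principal (suc t) - + suc t * S ∎
    where
    S = sumℤ n (λ z → M x z * bordered t z y)
    term : Fin (suc t) → Vec (Fin n) (suc t) → ℤ
    term b v = signℤ (suc (toℕ b)) * (M x (Vec.lookup v b) * det (suc t) (minor (sub M (x ∷ v) (y ∷ v)) (suc b)))
    neg-in : ∀ a s → a * (- s) ≡ - (a * s)
    neg-in = solve-∀
    neg-out : ∀ a s → (- a) * s ≡ - (a * s)
    neg-out = solve-∀
    each : ∀ b → sumT (suc t) (term b) ≡ - S
    each b = begin
      sumT (suc t) (term b)
        ≡⟨ sumT-insertAt t b (term b) ⟩
      sumℤ n (λ z → sumT t (λ w → term b (insertAt w b z)))
        ≡⟨ sum-cong n (λ z → trans (sumT-cong t (bordered-expand t x y b z))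
             (trans (sumT-*ˡ t (- M x z) (λ w → det (suc t) (sub M (z ∷ w) (y ∷ w))))
                    (neg-out (M x z) (bordered t z y)))) ⟩
      sumℤ n (λ z → - (M x z * bordered t z y))
        ≡⟨ sum-neg n (λ z → M x z * bordered t z y) ⟩
      - S ∎

  mutual
    -- The factor t + 1 is split into t and 1 to match `iterateM`, which receives the previous time
    -- t as a variable.
    iterate : ℕ → Matrix n
    iterate zero    x y = if ⌊ x ≟ y ⌋ then + 1 else + 0
    iterate (suc t) x y =
      (if ⌊ x ≟ y ⌋ then sumℤ n (λ z → image t z z) else + 0) - + t * image t x y - image t x y

    image : ℕ → Matrix n
    image t x y = sumℤ n (λ z → M x z * iterate t z y)

  sum-diagonal : ∀ x y c → sumℤ n (λ z → M x z * (if ⌊ z ≟ y ⌋ then c else + 0)) ≡ M x y * c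
  sum-diagonal x y c = go n (M x) y
    where
    go : ∀ n (r : Fin n → ℤ) y → sumℤ n (λ z → r z * (if ⌊ z ≟ y ⌋ then c else + 0)) ≡ r y * c
    go (suc n) r y = begin
      sumℤ (suc n) f                             ≡⟨ sum-punchIn y f ⟩
      f y + sumℤ n (λ z → f (punchIn y z))       ≡⟨ cong₂ _+_ at (trans (sum-cong n off) (sum-0 n)) ⟩
      r y * c + + 0                              ≡⟨ +-identityʳ _ ⟩
      r y * c                                    ∎
      where
      f : Fin (suc n) → ℤ
      f z = r z * (if ⌊ z ≟ y ⌋ then c else + 0)
      at : f y ≡ r y * c
      at with y ≟ y
      ... | yes _ = refl
      ... | no ne = ⊥-elim (ne refl)
      off : ∀ z → f (punchIn y z) ≡ + 0
      off z with punchIn y z ≟ y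
      ... | yes e = ⊥-elim (punchInᵢ≢i y z e)
      ... | no _  = *-zeroʳ (r (punchIn y z))

  image≡bordered : ∀ t x y → image t x y ≡ bordered t x y
  image≡bordered zero    x y = trans (sum-diagonal x y (+ 1)) (only (M x y))
    where
    only : ∀ a → a * + 1 ≡ + 1 * (a * + 1) + + 0
    only = solve-∀
  image≡bordered (suc t) x y = begin
    sumℤ n (λ z → M x z * (diag z - + t * image t z y - image t z y))
      ≡⟨ sum-cong n (λ z → trans (spread (M x z) (diag z) (+ t) (image t z y))
           (cong (λ g → M x z * diag z + (- (+ suc t)) * (M x z * g)) (image≡bordered t z y))) ⟩
    sumℤ n (λ z → M x z * diag z + (- (+ suc t)) * (M x z * bordered t z y))
      ≡⟨ sum-+ n (λ z → M x z * diag z) _ ⟩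
    sumℤ n (λ z → M x z * diag z) + sumℤ n (λ z → (- (+ suc t)) * (M x z * bordered t z y))
      ≡⟨ cong₂ _+_ (sum-diagonal x y _) (sum-*ˡ n (- (+ suc t)) (λ z → M x z * bordered t z y)) ⟩
    M x y * sumℤ n (λ z → image t z z) + (- (+ suc t)) * S
      -- The trace of `bordered t` is `principal (suc t)` by the definition of `sumT`.
      ≡⟨ cong₂ (λ u v → M x y * u + v) (sum-cong n (λ z → image≡bordered t z z)) (neg-out (+ suc t) S) ⟩
    M x y * principal (suc t) - + suc t * S
      ≡⟨ bordered-suc t x y ⟨
    bordered (suc t) x y ∎
    where
    S = sumℤ n (λ z → M x z * bordered t z y)
    diag : Fin n → ℤ
    diag z = if ⌊ z ≟ y ⌋ then sumℤ n (λ z → image t z z) else + 0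
    spread : ∀ m d t g → m * (d - t * g - g) ≡ m * d + (- (+ 1 + t)) * (m * g)
    spread = solve-∀
    neg-out : ∀ a s → (- a) * s ≡ - (a * s)
    neg-out = solve-∀

-- Determinants along tuples with repetitions or permutations

toℕ-punchIn-< : ∀ {n} (b : Fin (suc n)) j → toℕ j ℕ.< toℕ b → toℕ (punchIn b j) ≡ toℕ j
toℕ-punchIn-< (suc b) zero    _       = refl
toℕ-punchIn-< (suc b) (suc j) (s≤s p) = cong suc (toℕ-punchIn-< b j p)

-- Bringing `i` to the front and then `j` before it, in rows and columns alike, keeps the
-- determinant and makes the first two rows equal.
det-repeated : ∀ {n k} (M : Matrix n) (f : Fin k → Fin n) {i j} → i ≢ j → f i ≡ f j →
  det k (λ a b → M (f a) (f b)) ≡ + 0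
det-repeated {k = suc zero} M f {zero} {zero} i≢j e = ⊥-elim (i≢j refl)
det-repeated {k = suc (suc k)} M f {i} {j} i≢j e = begin
  det (suc (suc k)) (λ a b → M (f a) (f b))   ≡⟨ det-toFront i (λ a b → M (f a) (f b)) ⟨
  det (suc (suc k)) (λ a b → M (g a) (g b))   ≡⟨ det-toFront (suc j') (λ a b → M (g a) (g b)) ⟨
  det (suc (suc k)) (λ a b → M (h a) (h b))   ≡⟨ det-equal-rows (λ a b → M (h a) (h b)) (λ b → cong (λ z → M z (h b)) same) ⟩
  + 0 ∎
  where
  j' = punchOut i≢j
  g h : Fin (suc (suc k)) → _
  g = f ∘ toFront i
  h = g ∘ toFront (suc j')
  same : h zero ≡ h (suc zero)
  same = trans (cong f (punchIn-punchOut i≢j)) (sym e)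

-- Moving the largest missing value to the front sorts f, unless f misses a value and hence repeats one.
module Selection {m : ℕ} (M : Matrix (suc m)) where

  Outcome : (Fin (suc m) → Fin (suc m)) → Set
  Outcome f = det (suc m) (λ a b → M (f a) (f b)) ≡ + 0 ⊎ det (suc m) (λ a b → M (f a) (f b)) ≡ det (suc m) M

  -- the first c values of f are the c largest indices in increasing order
  Placed : ℕ → (Fin (suc m) → Fin (suc m)) → Set
  Placed c f = ∀ j → toℕ j ℕ.< c → toℕ (f j) ℕ.+ c ≡ suc m ℕ.+ toℕ j

  -- The values 0, ..., r - 1 are still to be placed, the largest of them next; when none is left,
  -- `f` is the identity.
  place : ∀ r c f → r ℕ.+ c ≡ suc m → Placed c f → Outcome f
  place zero .(suc m) f refl placed = inj₂ (det-cong (suc m) λ a b → cong₂ M (fixed a) (fixed b))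
    where
    fixed : ∀ j → f j ≡ j
    fixed j = toℕ-injective (ℕ.+-cancelʳ-≡ (suc m) _ _
      (trans (placed j (toℕ<n j)) (ℕ.+-comm (suc m) (toℕ j))))
  place (suc r) c f total placed with any? (λ b → f b ≟ value)
    where
    value : Fin (suc m)
    value = fromℕ< {r} (subst (suc r ℕ.≤_) total (ℕ.m≤m+n (suc r) c))
  ... | no absent = inj₁ (det-repeated M f (<⇒≢ (proj₁ (proj₂ (proj₂ hit))))
                           (punchOut-injective (miss _) (miss _) (proj₂ (proj₂ (proj₂ hit)))))
    where
    miss : ∀ j → _ ≢ f j
    miss j e = absent (j , sym e)
    hit = pigeonhole (ℕ.n<1+n m) (λ j → punchOut (miss j))
  ... | yes (b , e) = back (place r (suc c) (f ∘ toFront b) (trans (ℕ.+-suc r c) total) placed')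
    where
    fb : toℕ (f b) ≡ r
    fb = trans (cong toℕ e) (toℕ-fromℕ< _)
    -- The placed values all exceed r, so r stands behind them, and bringing it to the front shifts
    -- them by one without changing their order.
    c≤b : c ℕ.≤ toℕ b
    c≤b = ℕ.≮⇒≥ λ b<c → ℕ.<-irrefl refl
      (ℕ.≤-trans (ℕ.≤-reflexive (trans (cong suc (trans (sym (placed b b<c)) (cong (ℕ._+ c) fb))) total)) (ℕ.m≤m+n (suc m) (toℕ b)))
    placed' : Placed (suc c) (f ∘ toFront b)
    placed' zero    _         = trans (cong (ℕ._+ suc c) fb) (trans (ℕ.+-suc r c) (trans total (sym (ℕ.+-identityʳ (suc m)))))
    placed' (suc j) (s≤s j<c) = trans (ℕ.+-suc (toℕ (f (punchIn b j))) c) (trans (cong suc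
      (trans (placed (punchIn b j) (subst (ℕ._< c) (sym stay) j<c)) (cong (suc m ℕ.+_) stay)))
      (sym (ℕ.+-suc (suc m) (toℕ j))))
      where
      stay : toℕ (punchIn b j) ≡ toℕ j
      stay = toℕ-punchIn-< b j (ℕ.<-≤-trans j<c c≤b)
    back : Outcome (f ∘ toFront b) → Outcome f
    back (inj₁ z) = inj₁ (trans (sym (det-toFront b (λ i j → M (f i) (f j)))) z)
    back (inj₂ z) = inj₂ (trans (sym (det-toFront b (λ i j → M (f i) (f j)))) z)

  outcome : ∀ f → Outcome f
  outcome f = place (suc m) 0 f (ℕ.+-identityʳ (suc m)) (λ j ())

-- Natural multiples of the determinant

Multiple : ℤ → Set → ℤ → Set
Multiple d Q s = Σ ℕ λ c → s ≡ + c * d × (Q → c ≢ 0)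

-- The coefficients are natural numbers, so nothing cancels: their sum is nonzero as soon as one of
-- them is.
sum-Multiple : ∀ {d} m {Q : Fin m → Set} {f : Fin m → ℤ} →
  (∀ i → Multiple d (Q i) (f i)) → Multiple d (∃ Q) (sumℤ m f)
sum-Multiple {d} zero    h = 0 , sym (*-zeroˡ d) , λ { (() , _) }
sum-Multiple {d} (suc m) h with h zero | sum-Multiple m (h ∘ suc)
... | c , e , p | c' , e' , p' = c ℕ.+ c' , trans (cong₂ _+_ e e') (sym (*-distribʳ-+ d (+ c) (+ c')))
  , λ { (zero , q) z → p q (ℕ.m+n≡0⇒m≡0 c z) ; (suc i , q) z → p' (i , q) (ℕ.m+n≡0⇒n≡0 c z) }

sumT-Multiple : ∀ {d n} k {Q : Vec (Fin n) k → Set} {F : Vec (Fin n) k → ℤ} →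
  (∀ v → Multiple d (Q v) (F v)) → Multiple d (∃ Q) (sumT k F)
sumT-Multiple zero h with h []
... | c , e , p = c , e , λ { ([] , q) → p q }
sumT-Multiple {n = n} (suc k) h with sum-Multiple n (λ x → sumT-Multiple k (λ v → h (x ∷ v)))
... | c , e , p = c , e , λ { (x ∷ v , q) → p (x , v , q) }

module _ {m : ℕ} (M : Matrix (suc m)) where
  open Leverrier M

  private
    -- The second condition excludes that the two determinants agree only because both are 0; the
    -- coefficient of such a tuple may be 0.
    Hit : Fin (suc m) → Vec (Fin (suc m)) m → Set
    Hit x v = det (suc m) (sub M (x ∷ v) (x ∷ v)) ≡ det (suc m) M × det (suc m) M ≢ + 0

    image-diagonal : ∀ x → Multiple (det (suc m) M) (∃ (Hit x)) (image m x x)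
    image-diagonal x with sumT-Multiple m (λ v → term v (Selection.outcome M (Vec.lookup (x ∷ v))))
      where
      term : ∀ v → Selection.Outcome M (Vec.lookup (x ∷ v)) →
             Multiple (det (suc m) M) (Hit x v) (det (suc m) (sub M (x ∷ v) (x ∷ v)))
      term v (inj₁ z) = 0 , trans z (sym (*-zeroˡ (det (suc m) M))) , λ (hit , ne) _ → ne (trans (sym hit) z)
      term v (inj₂ z) = 1 , trans z (sym (*-identityˡ (det (suc m) M))) , λ _ ()
    ... | c , e , p = c , trans (image≡bordered m x x) e , p

  image≢0⇒det≢0 : ∀ x → image m x x ≢ + 0 → det (suc m) M ≢ + 0
  image≢0⇒det≢0 x ne z with image-diagonal x
  ... | c , e , _ = ne (trans e (trans (cong (+ c *_) z) (*-zeroʳ (+ c))))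

  det≢0⇒image≢0 : det (suc m) M ≢ + 0 → image m zero zero ≢ + 0
  det≢0⇒image≢0 ne z with image-diagonal zero
  ... | c , e , p with i*j≡0⇒i≡0∨j≡0 (+ c) (trans (sym e) z)
  -- The tuple 1, ..., m behind the border index 0 enumerates all indices in order, so its minor is
  -- `det M` itself.
  ...   | inj₁ c≡0 = p (tabulate suc , det-cong (suc m) (λ a b → cong₂ M (id-at a) (id-at b)) , ne) (+-injective c≡0)
    where
    id-at : ∀ a → Vec.lookup (zero ∷ tabulate suc) a ≡ a
    id-at zero    = refl
    id-at (suc a) = lookup∘tabulate suc a
  ...   | inj₂ d≡0 = ne d≡0

-- Boolean reflection

false≢true : ∀ {X : Set} → false ≡ true → X
false≢true ()

record Reflects (b : Bool) (P : Set) : Set where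
  constructor reflects
  field
    to   : b ≡ true → P
    from : P → b ≡ true

open Reflects public

reflects-≡ : ∀ {a b P} → Reflects a P → Reflects b P → a ≡ b
reflects-≡ {true}  {b}     p q = sym (from q (to p refl))
reflects-≡ {false} {false} p q = refl
reflects-≡ {false} {true}  p q = from p (to q refl)

reflects-id : ∀ {b} → Reflects b (b ≡ true)
reflects-id = reflects (λ e → e) (λ e → e)

reflects-∧ : ∀ {a b P Q} → Reflects a P → Reflects b Q → Reflects (a ∧ b) (P × Q)
reflects-∧ {true}  p q = reflects (λ e → to p refl , to q e) (λ (_ , y) → from q y)
reflects-∧ {false} p q = reflects (λ ()) (λ (x , _) → false≢true (from p x))

reflects-∨ : ∀ {a b P Q} → Reflects a P → Reflects b Q → Reflects (a ∨ b) (P ⊎ Q)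
reflects-∨ {true}  p q = reflects (λ _ → inj₁ (to p refl)) (λ _ → refl)
reflects-∨ {false} p q = reflects (λ e → inj₂ (to q e)) λ { (inj₁ x) → false≢true (from p x) ; (inj₂ y) → from q y }

reflects-not : ∀ {a P} → Reflects a P → Reflects (not a) (¬ P)
reflects-not {true}  p = reflects (λ ()) (λ ¬x → ⊥-elim (¬x (to p refl)))
reflects-not {false} p = reflects (λ _ x → false≢true (from p x)) (λ _ → refl)

reflects-→ : ∀ {a b P Q} → Reflects a P → Reflects b Q → Reflects (not a ∨ b) (P → Q)
reflects-→ {true}  p q = reflects (λ e _ → to q e) (λ f → from q (f (to p refl)))
reflects-→ {false} p q = reflects (λ _ x → false≢true (from p x)) (λ _ → refl)

reflects-any : ∀ m {f : Fin m → Bool} {P : Fin m → Set} →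
  (∀ i → Reflects (f i) (P i)) → Reflects (anyFin m f) (∃ P)
reflects-any zero    h = reflects (λ ()) (λ { (() , _) })
reflects-any (suc m) h = reflects
  (λ e → [ (λ p → zero , p) , (λ (i , p) → suc i , p) ]′ (to disj e))
  (λ { (zero , p) → from disj (inj₁ p) ; (suc i , p) → from disj (inj₂ (i , p)) })
  where disj = reflects-∨ (h zero) (reflects-any m (h ∘ suc))

reflects-all : ∀ m {f : Fin m → Bool} {P : Fin m → Set} →
  (∀ i → Reflects (f i) (P i)) → Reflects (allFin m f) (∀ i → P i)
reflects-all m {f} {P} h = reflects
  (λ e i → decide (λ ¬p → to none e (i , ¬p)))
  (λ p → from none λ (i , ¬p) → ¬p (p i))
  where
  none : Reflects (allFin m f) (¬ ∃ λ i → ¬ P i)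
  none = reflects-not (reflects-any m (λ i → reflects-not (h i)))
  decide : ∀ {i} → ¬ ¬ P i → P i
  decide {i} ¬¬p with f i | h i
  ... | true  | r = to r refl
  ... | false | r = ⊥-elim (¬¬p λ p → false≢true (from r p))

reflects-⌊⌋ : ∀ {P : Set} (d : Dec P) → Reflects ⌊ d ⌋ P
reflects-⌊⌋ (yes p) = reflects (λ _ → p) (λ _ → refl)
reflects-⌊⌋ (no ¬p) = reflects (λ ()) (λ p → ⊥-elim (¬p p))

reflects-<ᵇ : ∀ m n → Reflects (m ℕ.<ᵇ n) (m ℕ.< n)
reflects-<ᵇ m n = reflects (λ e → ℕ.<ᵇ⇒< m n (Equivalence.from T-≡ e)) (λ lt → Equivalence.to T-≡ (ℕ.<⇒<ᵇ lt))

reflects-≡ᵇ : ∀ m n → Reflects (m ℕ.≡ᵇ n) (m ≡ n)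
reflects-≡ᵇ m n = reflects (λ e → ℕ.≡ᵇ⇒≡ m n (Equivalence.from T-≡ e)) (λ eq → Equivalence.to T-≡ (ℕ.≡⇒≡ᵇ m n eq))

anyFin-cong : ∀ m {f g : Fin m → Bool} → (∀ i → f i ≡ g i) → anyFin m f ≡ anyFin m g
anyFin-cong zero    h = refl
anyFin-cong (suc m) h = cong₂ _∨_ (h zero) (anyFin-cong m (h ∘ suc))

countFin-cong : ∀ m {f g : Fin m → Bool} → (∀ i → f i ≡ g i) → countFin m f ≡ countFin m g
countFin-cong zero    h = refl
countFin-cong (suc m) h = cong₂ (λ b c → (if b then 1 else 0) ℕ.+ c) (h zero) (countFin-cong m (h ∘ suc))

countFin≤ : ∀ m f → countFin m f ℕ.≤ m
countFin≤ zero    f = z≤n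
countFin≤ (suc m) f = ℕ.+-mono-≤ (bit≤1 (f zero)) (countFin≤ m (f ∘ suc))
  where
  bit≤1 : ∀ b → (if b then 1 else 0) ℕ.≤ 1
  bit≤1 true  = ℕ.≤-refl
  bit≤1 false = z≤n

countFin-true : ∀ m {f : Fin m → Bool} → (∀ i → f i ≡ true) → countFin m f ≡ m
countFin-true zero    h = refl
countFin-true (suc m) {f} h = cong₂ (λ b c → (if b then 1 else 0) ℕ.+ c) (h zero) (countFin-true m (h ∘ suc))

countFin-false : ∀ m {f : Fin m → Bool} → (∀ i → f i ≡ false) → countFin m f ≡ 0
countFin-false zero    h = refl
countFin-false (suc m) {f} h = cong₂ (λ b c → (if b then 1 else 0) ℕ.+ c) (h zero) (countFin-false m (h ∘ suc))

-- Binary numbers, least significant digit first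

bit : Bool → ℕ
bit b = if b then 1 else 0

value : ∀ L → (Fin L → ℕ) → ℕ
value zero    d = 0
value (suc L) d = d zero ℕ.+ 2 ℕ.* value L (d ∘ suc)

value-cong : ∀ L {d e : Fin L → ℕ} → (∀ i → d i ≡ e i) → value L d ≡ value L e
value-cong zero    h = refl
value-cong (suc L) h = cong₂ (λ x y → x ℕ.+ 2 ℕ.* y) (h zero) (value-cong L (h ∘ suc))

value-+ : ∀ L (d e : Fin L → ℕ) → value L (λ i → d i ℕ.+ e i) ≡ value L d ℕ.+ value L e
value-+ zero    d e = refl
value-+ (suc L) d e = trans (cong (λ y → d zero ℕ.+ e zero ℕ.+ 2 ℕ.* y) (value-+ L (d ∘ suc) (e ∘ suc)))
                            (shuffle (d zero) (e zero) (value L (d ∘ suc)) (value L (e ∘ suc)))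
  where
  shuffle : ∀ a b c d → a ℕ.+ b ℕ.+ 2 ℕ.* (c ℕ.+ d) ≡ (a ℕ.+ 2 ℕ.* c) ℕ.+ (b ℕ.+ 2 ℕ.* d)
  shuffle = ℕRing.solve-∀

value-0 : ∀ L {d : Fin L → ℕ} → (∀ i → d i ≡ 0) → value L d ≡ 0
value-0 zero    h = refl
value-0 (suc L) h = cong₂ (λ x y → x ℕ.+ 2 ℕ.* y) (h zero) (value-0 L (h ∘ suc))

value≡0⇒ : ∀ L {d : Fin L → ℕ} → value L d ≡ 0 → ∀ i → d i ≡ 0
value≡0⇒ (suc L) {d} e zero    = ℕ.m+n≡0⇒m≡0 (d zero) e
value≡0⇒ (suc L) {d} e (suc i) = value≡0⇒ L (ℕ.m+n≡0⇒m≡0 (value L (d ∘ suc)) (ℕ.m+n≡0⇒n≡0 (d zero) e)) i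

value-not : ∀ L (a : Fin L → Bool) → suc (value L (bit ∘ not ∘ a) ℕ.+ value L (bit ∘ a)) ≡ 2 ^ L
value-not zero    a = refl
value-not (suc L) a = trans (low (a zero)) (cong (2 ℕ.*_) (value-not L (a ∘ suc)))
  where
  x = value L (bit ∘ not ∘ a ∘ suc)
  y = value L (bit ∘ a ∘ suc)
  low₁ : ∀ x y → suc ((0 ℕ.+ 2 ℕ.* x) ℕ.+ (1 ℕ.+ 2 ℕ.* y)) ≡ 2 ℕ.* suc (x ℕ.+ y)
  low₁ = ℕRing.solve-∀
  low₀ : ∀ x y → suc ((1 ℕ.+ 2 ℕ.* x) ℕ.+ (0 ℕ.+ 2 ℕ.* y)) ≡ 2 ℕ.* suc (x ℕ.+ y)
  low₀ = ℕRing.solve-∀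
  low : ∀ b → suc ((bit (not b) ℕ.+ 2 ℕ.* x) ℕ.+ (bit b ℕ.+ 2 ℕ.* y)) ≡ 2 ℕ.* suc (x ℕ.+ y)
  low true  = low₁ x y
  low false = low₀ x y

value-bit<2^ : ∀ L (a : Fin L → Bool) → value L (bit ∘ a) ℕ.< 2 ^ L
value-bit<2^ L a = ℕ.≤-trans (s≤s (ℕ.m≤n+m _ _)) (ℕ.≤-reflexive (value-not L a))

value-count : ∀ L m (a : Fin m → Fin L → Bool) →
  + value L (λ i → countFin m (λ z → a z i)) ≡ sumℤ m (λ z → + value L (bit ∘ a z))
value-count L zero    a = cong +_ (value-0 L (λ _ → refl))
value-count L (suc m) a = trans (cong +_ (value-+ L (bit ∘ a zero) (λ i → countFin m (λ z → a (suc z) i))))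
                                (cong (_+_ (+ value L (bit ∘ a zero))) (value-count L m (a ∘ suc)))

majority : Bool → Bool → Bool → Bool
majority x y c = (x ∧ y) ∨ ((x ∨ y) ∧ c)

-- The carry that enters position q; the argument `c` enters position 0.
carry : ∀ {L} → (Fin L → Bool) → (Fin L → Bool) → Bool → Fin L → Bool
carry a b c zero    = c
carry a b c (suc q) = carry (a ∘ suc) (b ∘ suc) (majority (a zero) (b zero) c) q

ripple : ∀ {L} → (Fin L → Bool) → (Fin L → Bool) → Bool → Fin L → Bool
ripple a b c q = (a q xor b q) xor carry a b c q

-- The witness `o` is the carry out of the highest position, which vanishes modulo 2 ^ L.
value-ripple : ∀ L (a b : Fin L → Bool) c → Σ ℕ λ o →
  value L (bit ∘ ripple a b c) ℕ.+ o ℕ.* 2 ^ L ≡ value L (bit ∘ a) ℕ.+ value L (bit ∘ b) ℕ.+ bit c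
value-ripple zero    a b c = bit c , ℕ.*-identityʳ (bit c)
value-ripple (suc L) a b c with value-ripple L (a ∘ suc) (b ∘ suc) (majority (a zero) (b zero) c)
... | o , e = o , trans (shift (bit ((a zero xor b zero) xor c)) (value L (bit ∘ ripple (a ∘ suc) (b ∘ suc) (majority (a zero) (b zero) c))) o (2 ^ L))
    (trans (cong (λ z → bit ((a zero xor b zero) xor c) ℕ.+ 2 ℕ.* z) e)
           (low (a zero) (b zero) c (value L (bit ∘ a ∘ suc)) (value L (bit ∘ b ∘ suc))))
  where
  shift : ∀ x v o w → x ℕ.+ 2 ℕ.* v ℕ.+ o ℕ.* (2 ℕ.* w) ≡ x ℕ.+ 2 ℕ.* (v ℕ.+ o ℕ.* w)
  shift = ℕRing.solve-∀
  digits : ∀ s m x y c v w → s ℕ.+ 2 ℕ.* m ≡ x ℕ.+ y ℕ.+ c →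
    s ℕ.+ 2 ℕ.* (v ℕ.+ w ℕ.+ m) ≡ (x ℕ.+ 2 ℕ.* v) ℕ.+ (y ℕ.+ 2 ℕ.* w) ℕ.+ c
  digits s m x y c v w e = trans (left s m v w) (trans (cong (ℕ._+ (2 ℕ.* v ℕ.+ 2 ℕ.* w)) e) (right x y c v w))
    where
    left : ∀ s m v w → s ℕ.+ 2 ℕ.* (v ℕ.+ w ℕ.+ m) ≡ (s ℕ.+ 2 ℕ.* m) ℕ.+ (2 ℕ.* v ℕ.+ 2 ℕ.* w)
    left = ℕRing.solve-∀
    right : ∀ x y c v w → (x ℕ.+ y ℕ.+ c) ℕ.+ (2 ℕ.* v ℕ.+ 2 ℕ.* w) ≡ (x ℕ.+ 2 ℕ.* v) ℕ.+ (y ℕ.+ 2 ℕ.* w) ℕ.+ c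
    right = ℕRing.solve-∀
  fullAdder : ∀ x y c → bit ((x xor y) xor c) ℕ.+ 2 ℕ.* bit (majority x y c) ≡ bit x ℕ.+ bit y ℕ.+ bit c
  fullAdder true  true  true  = refl
  fullAdder true  true  false = refl
  fullAdder true  false true  = refl
  fullAdder true  false false = refl
  fullAdder false true  true  = refl
  fullAdder false true  false = refl
  fullAdder false false true  = refl
  fullAdder false false false = refl
  low : ∀ x y c v w → bit ((x xor y) xor c) ℕ.+ 2 ℕ.* (v ℕ.+ w ℕ.+ bit (majority x y c)) ≡
        (bit x ℕ.+ 2 ℕ.* v) ℕ.+ (bit y ℕ.+ 2 ℕ.* w) ℕ.+ bit c
  low x y c v w = digits (bit ((x xor y) xor c)) (bit (majority x y c)) (bit x) (bit y) (bit c) v w (fullAdder x y c)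

Propagates : ∀ {L} → (Fin L → Bool) → (Fin L → Bool) → Fin L → Set
Propagates a b u = a u ≡ true ⊎ b u ≡ true

-- Carry lookahead: a carry arises at some r below q and passes through every position in between.
-- Only positions are quantified, so the recursion for the carry becomes a first-order condition.
Generates : ∀ {L} → (Fin L → Bool) → (Fin L → Bool) → Fin L → Set
Generates {L} a b q = Σ (Fin L) λ r → toℕ r ℕ.< toℕ q × (a r ≡ true × b r ≡ true) ×
  (∀ u → toℕ r ℕ.< toℕ u × toℕ u ℕ.< toℕ q → Propagates a b u)

reflects-majority : ∀ x y c → Reflects (majority x y c) ((x ≡ true × y ≡ true) ⊎ ((x ≡ true ⊎ y ≡ true) × c ≡ true))
reflects-majority x y c = reflects-∨ (reflects-∧ reflects-id reflects-id)
                                     (reflects-∧ (reflects-∨ reflects-id reflects-id) reflects-id)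

-- The induction removes the lowest digit and absorbs it into the initial carry, which therefore has
-- to be arbitrary; it reaches q if every position below q propagates.
reflects-carry : ∀ {L} (a b : Fin L → Bool) c q → Reflects (carry a b c q)
  (Generates a b q ⊎ (c ≡ true × (∀ u → toℕ u ℕ.< toℕ q → Propagates a b u)))
reflects-carry a b c zero = reflects (λ e → inj₂ (e , λ u ())) λ { (inj₁ (r , () , _)) ; (inj₂ (e , _)) → e }
reflects-carry a b c (suc q) = reflects (λ e → up (to ih e)) (λ g → from ih (down g))
  where
  a' = a ∘ suc
  b' = b ∘ suc
  ih = reflects-carry a' b' (majority (a zero) (b zero) c) q
  maj = reflects-majority (a zero) (b zero) c
  up : Generates a' b' q ⊎ (majority (a zero) (b zero) c ≡ true × (∀ u → toℕ u ℕ.< toℕ q → Propagates a' b' u)) →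
       Generates a b (suc q) ⊎ (c ≡ true × (∀ u → toℕ u ℕ.< suc (toℕ q) → Propagates a b u))
  up (inj₁ (r , r<q , gen , prop)) = inj₁ (suc r , s≤s r<q , gen ,
    λ { zero (() , _) ; (suc u) (s≤s lo , s≤s hi) → prop u (lo , hi) })
  up (inj₂ (m , prop)) with to maj m
  ... | inj₁ gen     = inj₁ (zero , s≤s z≤n , gen , λ { zero (() , _) ; (suc u) (_ , s≤s hi) → prop u hi })
  ... | inj₂ (p , e) = inj₂ (e , λ { zero _ → p ; (suc u) (s≤s hi) → prop u hi })
  down : Generates a b (suc q) ⊎ (c ≡ true × (∀ u → toℕ u ℕ.< suc (toℕ q) → Propagates a b u)) →
         Generates a' b' q ⊎ (majority (a zero) (b zero) c ≡ true × (∀ u → toℕ u ℕ.< toℕ q → Propagates a' b' u))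
  down (inj₁ (zero , _ , gen , prop)) = inj₂ (from maj (inj₁ gen) , λ u hi → prop (suc u) (s≤s z≤n , s≤s hi))
  down (inj₁ (suc r , s≤s r<q , gen , prop)) = inj₁ (r , r<q , gen , λ u (lo , hi) → prop (suc u) (s≤s lo , s≤s hi))
  down (inj₂ (e , prop)) = inj₂ (from maj (inj₂ (prop zero (s≤s z≤n) , e)) , λ u hi → prop (suc u) (s≤s hi))

-- Digit positions are pairs, ordered lexicographically

flat : ∀ {N} {X : Set} → (Fin N → Fin N → X) → Fin (N ℕ.* N) → X
flat {N} a i = a (quotient {N} N i) (remainder {N} N i)

flat-combine : ∀ {N} {X : Set} (a : Fin N → Fin N → X) p₁ p₂ → flat a (combine p₁ p₂) ≡ a p₁ p₂
flat-combine a p₁ p₂ = cong (λ (x , y) → a x y) (remQuot-combine p₁ p₂)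

Lex : ∀ {N} → Fin N → Fin N → Fin N → Fin N → Set
Lex r₁ r₂ q₁ q₂ = toℕ r₁ ℕ.< toℕ q₁ ⊎ (r₁ ≡ q₁ × toℕ r₂ ℕ.< toℕ q₂)

Lex⇒combine : ∀ {N} {r₁ r₂ q₁ q₂ : Fin N} → Lex r₁ r₂ q₁ q₂ → toℕ (combine r₁ r₂) ℕ.< toℕ (combine q₁ q₂)
Lex⇒combine {r₂ = r₂} {q₂ = q₂} (inj₁ lt) = combine-monoˡ-< r₂ q₂ lt
Lex⇒combine {N} {r₁} {r₂} {_} {q₂} (inj₂ (refl , lt)) =
  subst₂ ℕ._<_ (sym (toℕ-combine r₁ r₂)) (sym (toℕ-combine r₁ q₂)) (ℕ.+-monoʳ-< (N ℕ.* toℕ r₁) lt)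

combine⇒Lex : ∀ {N} {r₁ r₂ q₁ q₂ : Fin N} → toℕ (combine r₁ r₂) ℕ.< toℕ (combine q₁ q₂) → Lex r₁ r₂ q₁ q₂
combine⇒Lex {r₁ = r₁} {r₂} {q₁} {q₂} lt with <-cmp r₁ q₁
... | tri< a _ _ = inj₁ a
... | tri> _ _ c = ⊥-elim (ℕ.<-asym lt (combine-monoˡ-< q₂ r₂ c))
... | tri≈ _ refl _ with <-cmp r₂ q₂
...   | tri< a _ _    = inj₂ (refl , a)
...   | tri≈ _ refl _ = ⊥-elim (ℕ.<-irrefl refl lt)
...   | tri> _ _ c    = ⊥-elim (ℕ.<-asym lt (Lex⇒combine (inj₂ (refl , c))))

LexGenerates : ∀ {N} → (a b : Fin N → Fin N → Bool) → Fin N → Fin N → Set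
LexGenerates {N} a b q₁ q₂ = Σ (Fin N) λ r₁ → Σ (Fin N) λ r₂ → Lex r₁ r₂ q₁ q₂ × (a r₁ r₂ ≡ true × b r₁ r₂ ≡ true) ×
  (∀ u₁ u₂ → Lex r₁ r₂ u₁ u₂ × Lex u₁ u₂ q₁ q₂ → a u₁ u₂ ≡ true ⊎ b u₁ u₂ ≡ true)

reflects-flat-carry : ∀ {N} (a b : Fin N → Fin N → Bool) q₁ q₂ →
  Reflects (carry (flat a) (flat b) false (combine q₁ q₂)) (LexGenerates a b q₁ q₂)
reflects-flat-carry {N} a b q₁ q₂ = reflects (λ e → down (to spec e)) (λ g → from spec (inj₁ (up g)))
  where
  spec = reflects-carry (flat a) (flat b) false (combine q₁ q₂)
  pair : ∀ i → combine (quotient {N} N i) (remainder {N} N i) ≡ i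
  pair = combine-remQuot {N} N
  down : _ → LexGenerates a b q₁ q₂
  down (inj₂ (() , _))
  down (inj₁ (r , r<q , gen , prop)) =
    quotient N r , remainder {N} N r ,
    combine⇒Lex (subst (λ z → toℕ z ℕ.< toℕ (combine q₁ q₂)) (sym (pair r)) r<q) , gen ,
    λ u₁ u₂ (lo , hi) → subst₂ (λ x y → x ≡ true ⊎ y ≡ true) (flat-combine a u₁ u₂) (flat-combine b u₁ u₂)
      (prop (combine u₁ u₂) (subst (λ z → toℕ z ℕ.< toℕ (combine u₁ u₂)) (pair r) (Lex⇒combine lo) , Lex⇒combine hi))
  up : LexGenerates a b q₁ q₂ → Generates (flat a) (flat b) (combine q₁ q₂)
  up (r₁ , r₂ , lt , (ga , gb) , prop) =
    combine r₁ r₂ , Lex⇒combine lt , (trans (flat-combine a r₁ r₂) ga , trans (flat-combine b r₁ r₂) gb) ,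
    λ u (lo , hi) → prop (quotient N u) (remainder {N} N u)
      ( combine⇒Lex (subst (λ z → toℕ (combine r₁ r₂) ℕ.< toℕ z) (sym (pair u)) lo)
      , combine⇒Lex (subst (λ z → toℕ z ℕ.< toℕ (combine q₁ q₂)) (sym (pair u)) hi))

-- Congruence of integers modulo a natural number

infix 4 _≈_[_]
record _≈_[_] (a b : ℤ) (w : ℕ) : Set where
  constructor mod
  field
    quot : ℤ
    equation : a ≡ b + quot * + w

≈-reflexive : ∀ {w a b} → a ≡ b → a ≈ b [ w ]
≈-reflexive {w} {a} refl = mod (+ 0) (lem a (+ w))
  where
  lem : ∀ a w → a ≡ a + + 0 * w
  lem = solve-∀

≈-trans : ∀ {w a b c} → a ≈ b [ w ] → b ≈ c [ w ] → a ≈ c [ w ]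
≈-trans {w} {a} {b} {c} (mod x p) (mod y q) = mod (y + x) (trans p (trans (cong (_+ x * + w) q) (lem c x y (+ w))))
  where
  lem : ∀ c x y w → (c + y * w) + x * w ≡ c + (y + x) * w
  lem = solve-∀

≈-sym : ∀ {w a b} → a ≈ b [ w ] → b ≈ a [ w ]
≈-sym {w} {a} {b} (mod x p) = mod (- x) (trans (lem b x (+ w)) (cong (_+ (- x) * + w) (sym p)))
  where
  lem : ∀ b x w → b ≡ (b + x * w) + (- x) * w
  lem = solve-∀

≈-+ : ∀ {w a b c d} → a ≈ b [ w ] → c ≈ d [ w ] → a + c ≈ b + d [ w ]
≈-+ {w} {a} {b} {c} {d} (mod x p) (mod y q) = mod (x + y) (trans (cong₂ _+_ p q) (lem b d x y (+ w)))
  where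
  lem : ∀ b d x y w → (b + x * w) + (d + y * w) ≡ (b + d) + (x + y) * w
  lem = solve-∀

≈-neg : ∀ {w a b} → a ≈ b [ w ] → - a ≈ - b [ w ]
≈-neg {w} {a} {b} (mod x p) = mod (- x) (trans (cong -_ p) (lem b x (+ w)))
  where
  lem : ∀ b x w → - (b + x * w) ≡ - b + (- x) * w
  lem = solve-∀

≈-sum : ∀ {w} m {f g : Fin m → ℤ} → (∀ i → f i ≈ g i [ w ]) → sumℤ m f ≈ sumℤ m g [ w ]
≈-sum zero    h = ≈-reflexive refl
≈-sum (suc m) h = ≈-+ (h zero) (≈-sum m (h ∘ suc))

≈0⇒≡0 : ∀ {w a} → ∣ a ∣ ℕ.< w → a ≈ + 0 [ w ] → a ≡ + 0
≈0⇒≡0 {w} {a} lt (mod x p) = trans p (trans (ℤ.+-identityˡ (x * + w)) (cong (_* + w) (ℤ.∣i∣≡0⇒i≡0 {x} (small ∣ x ∣ refl))))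
  where
  small : ∀ q → ∣ x ∣ ≡ q → q ≡ 0
  small zero    _ = refl
  small (suc m) e = ⊥-elim (ℕ.<⇒≱ lt (ℕ.≤-trans (ℕ.m≤m+n w (m ℕ.* w)) (ℕ.≤-reflexive (sym size))))
    where
    size : ∣ a ∣ ≡ suc m ℕ.* w
    size = trans (cong ∣_∣ (trans p (ℤ.+-identityˡ (x * + w)))) (trans (ℤ.abs-* x (+ w)) (cong (ℕ._* w) e))

value-add : ∀ L (a b : Fin L → Bool) →
  + value L (bit ∘ ripple a b false) ≈ + value L (bit ∘ a) + + value L (bit ∘ b) [ 2 ^ L ]
value-add L a b with value-ripple L a b false
... | o , e = mod (- (+ o)) (trans (lem (+ value L (bit ∘ ripple a b false)) (+ o) (+ (2 ^ L)))
    (cong (_+ - (+ o) * + (2 ^ L)) (trans (cong (_+_ (+ value L (bit ∘ ripple a b false))) (sym (ℤ.pos-* o (2 ^ L))))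
      (trans (cong +_ e) (cong +_ (ℕ.+-identityʳ _))))))
  where
  lem : ∀ v o w → v ≡ (v + o * w) + (- o) * w
  lem = solve-∀

-- Two's complement: a number and its digitwise complement add up to 2 ^ L - 1, the number with all
-- digits 1.
value-neg : ∀ L (a : Fin L → Bool) → + value L (bit ∘ not ∘ a) ≈ - (+ 1) - + value L (bit ∘ a) [ 2 ^ L ]
value-neg L a = mod (+ 1) (trans (lem (+ value L (bit ∘ not ∘ a)) (+ value L (bit ∘ a)))
    (cong (λ z → - (+ 1) - + value L (bit ∘ a) + + 1 * z) (cong +_ (value-not L a))))
  where
  lem : ∀ n v → n ≡ - (+ 1) - v + + 1 * (+ 1 + (n + v))
  lem = solve-∀

-- Renaming

Ren : {X : Set} → List X → List X → Set
Ren Γ Γ' = ∀ {s} → s ∈ Γ → s ∈ Γ'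

lift : {X : Set} {Γ Γ' : List X} {s : X} → Ren Γ Γ' → Ren (s ∷ Γ) (s ∷ Γ')
lift w (here e)  = here e
lift w (there v) = there (w v)

lifts : {X : Set} {Γ Γ' : List X} (a : List X) → Ren Γ Γ' → Ren (a ++ Γ) (a ++ Γ')
lifts []      w v = w v
lifts (s ∷ a) w   = lift (lifts a w)

mutual
  renT : ∀ {Γ Γ' Δ Δ' s} → Ren Γ Γ' → Ren Δ Δ' → Term Γ Δ s → Term Γ' Δ' s
  renT w r (var v)     = var (w v)
  renT w r (count s φ) = count s (ren (lift w) r φ)

  renTs : ∀ {Γ Γ' Δ Δ' a} → Ren Γ Γ' → Ren Δ Δ' → All (Term Γ Δ) a → All (Term Γ' Δ') a
  renTs w r []       = []
  renTs w r (t ∷ ts) = renT w r t ∷ renTs w r ts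

  ren : ∀ {Γ Γ' Δ Δ'} → Ren Γ Γ' → Ren Δ Δ' → Formula Γ Δ → Formula Γ' Δ'
  ren w r (eq t u)     = eq (renT w r t) (renT w r u)
  ren w r (lessB t u)  = lessB (renT w r t) (renT w r u)
  ren w r (succN t u)  = succN (renT w r t) (renT w r u)
  ren w r (bitM i j s) = bitM (renT w r i) (renT w r j) (renT w r s)
  ren w r (posM i j)   = posM (renT w r i) (renT w r j)
  ren w r (rel x ts)   = rel (r x) (renTs w r ts)
  ren w r (neg φ)      = neg (ren w r φ)
  ren w r (and φ ψ)    = and (ren w r φ) (ren w r ψ)
  ren w r (or φ ψ)     = or (ren w r φ) (ren w r ψ)
  ren w r (ex s φ)     = ex s (ren (lift w) r φ)
  ren w r (all s φ)    = all s (ren (lift w) r φ)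
  ren w r (ifp a φ ts) = ifp a (ren (lifts a w) (lift r) φ) (renTs w r ts)

module Renaming (𝔄 : MStr) where
  open Sem 𝔄

  record Agree {Γ Γ'} (w : Ren Γ Γ') (e : All ⟦_⟧ Γ) (e' : All ⟦_⟧ Γ') : Set where
    constructor agree
    field at : ∀ {s} (v : s ∈ Γ) → lookup e' (w v) ≡ lookup e v

  -- Agreement is pointwise because the stages of a fixed point and of its renaming are compared
  -- tuple by tuple, not as functions.
  record RAgree {Δ Δ'} (r : Ren Δ Δ') (ρ : All RelVal Δ) (ρ' : All RelVal Δ') : Set where
    constructor ragree
    field at : ∀ {a} (x : a ∈ Δ) ts → lookup ρ' (r x) ts ≡ lookup ρ x ts

  agree-lift : ∀ {Γ Γ'} s (w : Ren Γ Γ') {e e'} (x : ⟦ s ⟧) → Agree w e e' → Agree (lift {s = s} w) (x ∷ e) (x ∷ e')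
  agree-lift s w x (agree h) = agree λ { (here refl) → refl ; (there v) → h v }

  agree-lifts : ∀ {Γ Γ'} a (w : Ren Γ Γ') {e e'} (t : Tuple a) → Agree w e e' → Agree (lifts a w) (++⁺ t e) (++⁺ t e')
  agree-lifts []      w []      h = h
  agree-lifts (s ∷ a) w (x ∷ t) h = agree-lift s (lifts a w) x (agree-lifts a w t h)

  ragree-lift : ∀ {Δ Δ' a} (r : Ren Δ Δ') {ρ ρ'} {R R' : RelVal a} → (∀ ts → R' ts ≡ R ts) →
                RAgree r ρ ρ' → RAgree (lift r) (R ∷ ρ) (R' ∷ ρ')
  ragree-lift r g (ragree h) = ragree λ { (here refl) → g ; (there x) → h x }

  mutual
    evalT-ren : ∀ {Γ Γ' Δ Δ' s} (w : Ren Γ Γ') (r : Ren Δ Δ') {e e' ρ ρ'} → Agree w e e' → RAgree r ρ ρ' →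
                (t : Term Γ Δ s) → evalT (renT w r t) e' ρ' ≡ evalT t e ρ
    evalT-ren w r h g (var v) = Agree.at h v
    evalT-ren w r h g (count {s} _ φ) =
      cong (toNum card) (countFin-cong (size s) λ x → eval-ren (lift {s = s} w) r (agree-lift s w x h) g φ)

    evalTs-ren : ∀ {Γ Γ' Δ Δ' a} (w : Ren Γ Γ') (r : Ren Δ Δ') {e e' ρ ρ'} → Agree w e e' → RAgree r ρ ρ' →
                 (ts : All (Term Γ Δ) a) → evalTs (renTs w r ts) e' ρ' ≡ evalTs ts e ρ
    evalTs-ren w r h g []       = refl
    evalTs-ren w r h g (t ∷ ts) = cong₂ _∷_ (evalT-ren w r h g t) (evalTs-ren w r h g ts)

    stage-ren : ∀ {Γ Γ' Δ Δ'} (w : Ren Γ Γ') (r : Ren Δ Δ') {e e' ρ ρ'} → Agree w e e' → RAgree r ρ ρ' →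
                ∀ a (φ : Formula (a ++ Γ) (a ∷ Δ)) i ts →
                stage a (ren (lifts a w) (lift r) φ) e' ρ' i ts ≡ stage a φ e ρ i ts
    stage-ren w r h g a φ zero    ts = refl
    stage-ren w r h g a φ (suc i) ts = cong₂ _∨_ (stage-ren w r h g a φ i ts)
      (eval-ren (lifts a w) (lift r) (agree-lifts a w ts h) (ragree-lift r (stage-ren w r h g a φ i) g) φ)

    eval-ren : ∀ {Γ Γ' Δ Δ'} (w : Ren Γ Γ') (r : Ren Δ Δ') {e e' ρ ρ'} → Agree w e e' → RAgree r ρ ρ' →
               (φ : Formula Γ Δ) → eval (ren w r φ) e' ρ' ≡ eval φ e ρ
    eval-ren w r h g (eq t u)     = cong₂ (λ x y → ⌊ x ≟ y ⌋) (evalT-ren w r h g t) (evalT-ren w r h g u)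
    eval-ren w r h g (lessB t u)  = cong₂ (λ x y → toℕ x ℕ.<ᵇ toℕ y) (evalT-ren w r h g t) (evalT-ren w r h g u)
    eval-ren w r h g (succN t u)  = cong₂ (λ x y → suc (toℕ x) ℕ.≡ᵇ toℕ y) (evalT-ren w r h g t) (evalT-ren w r h g u)
    eval-ren w r h g (bitM i j s) = trans
      (cong₂ (λ x y → MStr.bitR 𝔄 x y _) (evalT-ren w r h g i) (evalT-ren w r h g j))
      (cong (MStr.bitR 𝔄 _ _) (evalT-ren w r h g s))
    eval-ren w r h g (posM i j)   = cong₂ (MStr.posR 𝔄) (evalT-ren w r h g i) (evalT-ren w r h g j)
    eval-ren w r {ρ = ρ} h g (rel x ts) = trans (RAgree.at g x _) (cong (lookup ρ x) (evalTs-ren w r h g ts))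
    eval-ren w r h g (neg φ)      = cong not (eval-ren w r h g φ)
    eval-ren w r h g (and φ ψ)    = cong₂ _∧_ (eval-ren w r h g φ) (eval-ren w r h g ψ)
    eval-ren w r h g (or φ ψ)     = cong₂ _∨_ (eval-ren w r h g φ) (eval-ren w r h g ψ)
    eval-ren w r h g (ex s φ)     = anyFin-cong (size s) λ x → eval-ren (lift {s = s} w) r (agree-lift s w x h) g φ
    eval-ren w r h g (all s φ)    = cong not (anyFin-cong (size s) λ x →
      cong not (eval-ren (lift {s = s} w) r (agree-lift s w x h) g φ))
    eval-ren w r {e} {e'} {ρ} {ρ'} h g (ifp a φ ts) = trans
      (stage-ren w r h g a φ (tupleCount a) (evalTs (renTs w r ts) e' ρ'))
      (cong (stage a φ e ρ (tupleCount a)) (evalTs-ren w r h g ts))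

-- Formulas for arithmetic

pattern v0 = here refl
pattern v1 = there v0
pattern v2 = there v1
pattern v3 = there v2
pattern v4 = there v3
pattern v5 = there v4
pattern v6 = there v5

-- The numerical sort has only a successor, so constants are obtained by counting. As the bit sort
-- is nonempty, `sizeβ` differs from `zeroT`, and the two can serve as flags.
sizeι sizeβ zeroT : ∀ {Γ Δ} → Term Γ Δ ν
sizeι = count ι (eq (var v0) (var v0))
sizeβ = count β (eq (var v0) (var v0))
zeroT = count β (lessB (var v0) (var v0))

falseF : ∀ {Γ Δ} → Formula Γ Δ
falseF = ex β (lessB (var v0) (var v0))

xorF : ∀ {Γ Δ} → Formula Γ Δ → Formula Γ Δ → Formula Γ Δ
xorF φ ψ = or (and φ (neg ψ)) (and (neg φ) ψ)

-- The order of the numerical sort is the transitive closure of its successor.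
ltBody : ∀ {Γ Δ} → Formula (ν ∷ ν ∷ Γ) ((ν ∷ ν ∷ []) ∷ Δ)
ltBody = or (succN (var v0) (var v1)) (ex ν (and (rel v0 (var v1 ∷ var v0 ∷ [])) (succN (var v0) (var v2))))

opaque
  ltN : ∀ {Γ Δ} → Term Γ Δ ν → Term Γ Δ ν → Formula Γ Δ
  ltN t u = ifp (ν ∷ ν ∷ []) ltBody (t ∷ u ∷ [])

lexF : ∀ {Γ Δ} (r₁ r₂ q₁ q₂ : ν ∈ Γ) → Formula Γ Δ
lexF r₁ r₂ q₁ q₂ = or (ltN (var r₁) (var q₁)) (and (eq (var r₁) (var q₁)) (ltN (var r₂) (var q₂)))

-- With free variables p₁, p₂ : ν and x, y : ι, a formula denotes an I-square matrix of integers modulo 2 ^ N²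
-- (N the size of the sort ν): it says that the entry at (x, y) has a digit 1 at the position p₁ N + p₂.
Num : Ctx → RCtx → Set
Num Γ Δ = Formula (ν ∷ ν ∷ ι ∷ ι ∷ Γ) Δ

-- The inner one of two quantifiers binds `v0`, where a `Num` expects the more significant
-- coordinate of the position.
swapIn : ∀ {Γ Γ' : Ctx} → Ren Γ Γ' → Ren (ν ∷ ν ∷ Γ) (ν ∷ ν ∷ Γ')
swapIn w v0 = v1
swapIn w v1 = v0
swapIn w (there (there v)) = there (there (w v))

id∈ : {X : Set} {Γ : List X} → Ren Γ Γ
id∈ v = v

genRen : ∀ {Γ : Ctx} → Ren (ν ∷ ν ∷ Γ) (ν ∷ ν ∷ ν ∷ ν ∷ Γ)
genRen = swapIn (λ v → there (there v))

propRen : ∀ {Γ : Ctx} → Ren (ν ∷ ν ∷ Γ) (ν ∷ ν ∷ ν ∷ ν ∷ ν ∷ ν ∷ Γ)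
propRen = swapIn (λ v → there (there (there (there v))))

-- This transcribes `LexGenerates`. Under all four quantifiers the variables from `v0` on are u₂,
-- u₁, r₂, r₁, q₁, q₂.
carryF : ∀ {Γ Δ} → Num Γ Δ → Num Γ Δ → Num Γ Δ
carryF {Γ} φ ψ = ex ν (ex ν (and (lexF v1 v0 v2 v3) (and
  (and (ren genRen id∈ φ) (ren genRen id∈ ψ))
  (all ν (all ν (or (neg (and (lexF v3 v2 v1 v0) (lexF v1 v0 v4 v5))) (or (ren propRen id∈ φ) (ren propRen id∈ ψ))))))))

opaque
  addM : ∀ {Γ Δ} → Num Γ Δ → Num Γ Δ → Num Γ Δ
  addM φ ψ = xorF (xorF φ ψ) (carryF φ ψ)

-- Complementing is a ↦ -1 - a, and -1 - ((-1 - a) + b) = a - b.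
subM : ∀ {Γ Δ} → Num Γ Δ → Num Γ Δ → Num Γ Δ
subM φ ψ = neg (addM (neg φ) ψ)

condM : ∀ {Γ Δ} → Formula (ι ∷ ι ∷ Γ) Δ → Num Γ Δ → Num Γ Δ
condM c φ = and (ren (λ v → there (there v)) id∈ c) φ

-- time, flag, digit position and matrix indices of the states of a loop; the flag 0 marks the times already reached
Loop : List Sort
Loop = ν ∷ ν ∷ ν ∷ ν ∷ ι ∷ ι ∷ []

-- Every nonzero flag carries the digits of the state; `sizeβ` is a term for such a flag.
stateM : ∀ {Γ Δ} → Num (ν ∷ Γ) (Loop ∷ Δ)
stateM = rel v0 (var v4 ∷ sizeβ ∷ var v0 ∷ var v1 ∷ var v2 ∷ var v3 ∷ [])

stepRen : ∀ {Γ} → Ren (ν ∷ ν ∷ ι ∷ ι ∷ ν ∷ Γ) (ν ∷ Loop ++ Γ)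
stepRen v0 = v3
stepRen v1 = v4
stepRen v2 = v5
stepRen v3 = v6
stepRen v4 = v0
stepRen (there (there (there (there (there v))))) = there (there (there (there (there (there (there v))))))

-- A digit computed from an incomplete state could never be withdrawn. So the state at time t is
-- added in one single stage: the first conjunct demands that t is not marked yet, the second that t
-- is 0 or its predecessor is marked. The mark of t is set in the same stage, which freezes its
-- state.
loopBody : ∀ {Γ Δ} → Num Γ Δ → Num (ν ∷ Γ) (Loop ∷ Δ) → Formula (Loop ++ Γ) (Loop ∷ Δ)
loopBody init step = and
  (neg (rel v0 (var v0 ∷ zeroT ∷ var v2 ∷ var v3 ∷ var v4 ∷ var v5 ∷ [])))
  (or (and (eq (var v0) zeroT) (or (eq (var v1) zeroT) (ren (λ v → there (there v)) there init)))
      (ex ν (and (succN (var v0) (var v1)) (and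
        (rel v0 (var v0 ∷ zeroT ∷ var v3 ∷ var v4 ∷ var v5 ∷ var v6 ∷ []))
        (or (eq (var v2) zeroT) (ren stepRen id∈ step))))))

-- The body of ifp also sees the variables at which the fixed point is applied; the renaming skips them.
opaque
  loopM : ∀ {Γ Δ} → Num Γ Δ → Num (ν ∷ Γ) (Loop ∷ Δ) → Term (ν ∷ ν ∷ ι ∷ ι ∷ Γ) Δ ν → Num Γ Δ
  loopM init step T = ifp Loop
    (ren (lifts Loop (λ v → there (there (there (there v))))) (lift id∈) (loopBody init step))
    (T ∷ sizeβ ∷ var v0 ∷ var v1 ∷ var v2 ∷ var v3 ∷ [])

wkNum : ∀ {Γ Δ s a} → Num Γ Δ → Num (s ∷ Γ) (a ∷ Δ)
wkNum = ren (lifts (ν ∷ ν ∷ ι ∷ ι ∷ []) there) there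

timesM : ∀ {Γ Δ} → Term (ν ∷ ν ∷ ι ∷ ι ∷ Γ) Δ ν → Num Γ Δ → Num Γ Δ
timesM T φ = loopM falseF (addM stateM (wkNum φ)) T

countRen : ∀ {Γ} → Ren (ν ∷ ν ∷ ι ∷ ι ∷ ι ∷ Γ) (ι ∷ ν ∷ ν ∷ ι ∷ ι ∷ ν ∷ Γ)
countRen v0 = v1
countRen v1 = v2
countRen v2 = v3
countRen v3 = v4
countRen v4 = v0
countRen (there (there (there (there (there v))))) = there (there (there (there (there (there v)))))

-- Σ_z φ(z) = Σ_{j<n} Σ_p 2^p [j < #{z : φ(z) has a digit 1 at p}]
sumM : ∀ {Γ Δ} → Num (ι ∷ Γ) Δ → Num Γ Δ
sumM φ = loopM falseF (addM stateM (ltN (var v4) (count ι (ren countRen there φ)))) sizeι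

-- Semantics of the arithmetic formulas

module Arithmetic (𝔄 : MStr) where
  open MStr 𝔄
  open Sem 𝔄
  open Renaming 𝔄

  N L W : ℕ
  N = suc card
  L = N ℕ.* N
  W = 2 ^ L

  ragree-id : ∀ {Δ} {ρ : All RelVal Δ} → RAgree id∈ ρ ρ
  ragree-id = ragree λ x ts → refl

  zeroV sizeιV sizeβV : Fin N
  zeroV  = toNum card (countFin (suc k) (λ s → toℕ s ℕ.<ᵇ toℕ s))
  sizeιV = toNum card (countFin n (λ x → ⌊ x ≟ x ⌋))
  sizeβV = toNum card (countFin (suc k) (λ s → ⌊ s ≟ s ⌋))

  toℕ-toNum : ∀ N m → m ℕ.≤ N → toℕ (toNum N m) ≡ m
  toℕ-toNum zero    zero    _       = refl
  toℕ-toNum (suc N) zero    _       = refl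
  toℕ-toNum (suc N) (suc m) (s≤s h) = cong suc (toℕ-toNum N m h)

  <ᵇ-irrefl : ∀ m → (m ℕ.<ᵇ m) ≡ false
  <ᵇ-irrefl zero    = refl
  <ᵇ-irrefl (suc m) = <ᵇ-irrefl m

  ≟-refl : ∀ {m} (x : Fin m) → ⌊ x ≟ x ⌋ ≡ true
  ≟-refl x = from (reflects-⌊⌋ (x ≟ x)) refl

  toℕ-zeroV : toℕ zeroV ≡ 0
  toℕ-zeroV = trans (cong (toℕ ∘ toNum card) (countFin-false (suc k) (λ s → <ᵇ-irrefl (toℕ s)))) (toℕ-toNum card 0 z≤n)

  toℕ-sizeιV : toℕ sizeιV ≡ n
  toℕ-sizeιV = trans (cong (toℕ ∘ toNum card) (countFin-true n ≟-refl)) (toℕ-toNum card n (ℕ.m≤m+n n (suc k)))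

  toℕ-sizeβV : toℕ sizeβV ≡ suc k
  toℕ-sizeβV = trans (cong (toℕ ∘ toNum card) (countFin-true (suc k) ≟-refl)) (toℕ-toNum card (suc k) (ℕ.m≤n+m (suc k) n))

  sizeβV≢zeroV : sizeβV ≢ zeroV
  sizeβV≢zeroV e with trans (sym toℕ-sizeβV) (trans (cong toℕ e) toℕ-zeroV)
  ... | ()

  falseF-false : ∀ {Γ Δ} (e : All ⟦_⟧ Γ) (ρ : All RelVal Δ) → eval falseF e ρ ≡ false
  falseF-false e ρ = go (suc k)
    where
    go : ∀ m → anyFin m (λ s → toℕ s ℕ.<ᵇ toℕ s) ≡ false
    go zero    = refl
    go (suc m) = go m

  eval-xorF : ∀ {Γ Δ} (φ ψ : Formula Γ Δ) e ρ → eval (xorF φ ψ) e ρ ≡ eval φ e ρ xor eval ψ e ρ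
  eval-xorF φ ψ e ρ = table (eval φ e ρ) (eval ψ e ρ)
    where
    table : ∀ a b → (a ∧ not b) ∨ (not a ∧ b) ≡ a xor b
    table true  true  = refl
    table true  false = refl
    table false b     = refl

  N≤NN : N ℕ.≤ N ℕ.* (N ℕ.* 1)
  N≤NN = ℕ.m≤m*n N (N ℕ.* 1)

  opaque
    unfolding ltN

    eval-ltN : ∀ {Γ Δ} (t u : Term Γ Δ ν) e ρ → eval (ltN t u) e ρ ≡
      stage (ν ∷ ν ∷ []) ltBody e ρ (N ℕ.* (N ℕ.* 1)) (evalT t e ρ ∷ evalT u e ρ ∷ [])
    eval-ltN t u e ρ = refl

  reflects-ltN : ∀ {Γ Δ} (t u : Term Γ Δ ν) e ρ → Reflects (eval (ltN t u) e ρ) (toℕ (evalT t e ρ) ℕ.< toℕ (evalT u e ρ))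
  reflects-ltN {Γ} {Δ} t u e ρ = reflects (λ h → proj₁ (to final (trans (sym (eval-ltN t u e ρ)) h)))
    (λ lt → trans (eval-ltN t u e ρ) (from final (lt , ℕ.≤-trans (ℕ.<⇒≤ (toℕ<n b₀)) (ℕ.≤-trans N≤NN (ℕ.m≤n+m _ (toℕ a₀))))))
    where
    a₀ = evalT t e ρ
    b₀ = evalT u e ρ
    St : ℕ → Fin N → Fin N → Bool
    St i a b = stage (ν ∷ ν ∷ []) ltBody e ρ i (a ∷ b ∷ [])
    -- Each stage extends the chains of successors by one, so after i stages exactly the differences
    -- 1, ..., i have been reached.
    Between : ℕ → Fin N → Fin N → Set
    Between i a b = toℕ a ℕ.< toℕ b × toℕ b ℕ.≤ toℕ a ℕ.+ i
    spec : ∀ i a b → Reflects (St i a b) (Between i a b)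
    spec zero a b = reflects (λ ()) λ (lo , hi) →
      ⊥-elim (ℕ.<⇒≱ lo (ℕ.≤-trans hi (ℕ.≤-reflexive (ℕ.+-identityʳ (toℕ a)))))
    spec (suc i) a b = reflects (λ h → fwd (to r h)) (λ h → from r (bwd h))
      where
      Step = Between i a b ⊎ (suc (toℕ a) ≡ toℕ b ⊎ ∃ λ c → Between i a c × suc (toℕ c) ≡ toℕ b)
      r : Reflects (St (suc i) a b) Step
      r = reflects-∨ (spec i a b) (reflects-∨ (reflects-≡ᵇ (suc (toℕ a)) (toℕ b))
            (reflects-any N λ c → reflects-∧ (spec i a c) (reflects-≡ᵇ (suc (toℕ c)) (toℕ b))))
      widen : ∀ {x} → x ℕ.≤ toℕ a ℕ.+ i → suc x ℕ.≤ toℕ a ℕ.+ suc i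
      widen h = ℕ.≤-trans (s≤s h) (ℕ.≤-reflexive (sym (ℕ.+-suc (toℕ a) i)))
      fwd : Step → Between (suc i) a b
      fwd (inj₁ (lo , hi)) = lo , ℕ.≤-trans (ℕ.n≤1+n _) (widen hi)
      fwd (inj₂ (inj₁ s)) = ℕ.≤-reflexive s , ℕ.≤-trans (ℕ.≤-reflexive (sym s)) (widen (ℕ.m≤m+n (toℕ a) i))
      fwd (inj₂ (inj₂ (c , (lo , hi) , s))) =
        ℕ.≤-trans lo (ℕ.≤-trans (ℕ.n≤1+n _) (ℕ.≤-reflexive s)) , ℕ.≤-trans (ℕ.≤-reflexive (sym s)) (widen hi)
      bwd : Between (suc i) a b → Step
      bwd (lo , hi) with ℕ.m≤n⇒m<n∨m≡n lo
      ... | inj₂ s    = inj₂ (inj₁ s)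
      ... | inj₁ more = inj₂ (inj₂ (c , (ca , cb) , csuc))
        where
        b≡ : suc (ℕ.pred (toℕ b)) ≡ toℕ b
        b≡ = ℕ.suc-pred (toℕ b) ⦃ ℕ.>-nonZero (ℕ.≤-trans (s≤s z≤n) lo) ⦄
        c : Fin N
        c = fromℕ< {ℕ.pred (toℕ b)} (ℕ.≤-trans (ℕ.≤-reflexive b≡) (ℕ.<⇒≤ (toℕ<n b)))
        csuc : suc (toℕ c) ≡ toℕ b
        csuc = trans (cong suc (toℕ-fromℕ< _)) b≡
        ca : toℕ a ℕ.< toℕ c
        ca = ℕ.≤-pred (ℕ.≤-trans more (ℕ.≤-reflexive (sym csuc)))
        cb : toℕ c ℕ.≤ toℕ a ℕ.+ i
        cb = ℕ.≤-pred (ℕ.≤-trans (ℕ.≤-reflexive csuc) (ℕ.≤-trans hi (ℕ.≤-reflexive (ℕ.+-suc (toℕ a) i))))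
    final = spec (N ℕ.* (N ℕ.* 1)) a₀ b₀

  reflects-lexF : ∀ {Γ Δ} (r₁ r₂ q₁ q₂ : ν ∈ Γ) e (ρ : All RelVal Δ) →
    Reflects (eval (lexF r₁ r₂ q₁ q₂) e ρ) (Lex (lookup e r₁) (lookup e r₂) (lookup e q₁) (lookup e q₂))
  reflects-lexF r₁ r₂ q₁ q₂ e ρ = reflects-∨ (reflects-ltN (var r₁) (var q₁) e ρ)
    (reflects-∧ (reflects-⌊⌋ (lookup e r₁ ≟ lookup e q₁)) (reflects-ltN (var r₂) (var q₂) e ρ))

  digits : ∀ {Γ Δ} → Num Γ Δ → All ⟦_⟧ Γ → All RelVal Δ → Fin n → Fin n → Fin N → Fin N → Bool
  digits φ e ρ x y p₁ p₂ = eval φ (p₁ ∷ p₂ ∷ x ∷ y ∷ e) ρ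

  opaque
    number : (Fin N → Fin N → Bool) → ℤ
    number a = + value L (bit ∘ flat a)

    number-cong : ∀ {a b} → (∀ p₁ p₂ → a p₁ p₂ ≡ b p₁ p₂) → number a ≡ number b
    number-cong h = cong +_ (value-cong L (λ i → cong bit (h (quotient {N} N i) (remainder {N} N i))))

    number-false : ∀ {a} → (∀ p₁ p₂ → a p₁ p₂ ≡ false) → number a ≡ + 0
    number-false h = cong +_ (value-0 L (λ i → cong bit (h (quotient {N} N i) (remainder {N} N i))))

    number-not : ∀ a → number (λ p₁ p₂ → not (a p₁ p₂)) ≈ - (+ 1) - number a [ W ]
    number-not a = value-neg L (flat a)

    number-ripple : ∀ a b {c} → (∀ p₁ p₂ → c p₁ p₂ ≡ ripple (flat a) (flat b) false (combine p₁ p₂)) →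
      number c ≈ number a + number b [ W ]
    number-ripple a b h = ≈-trans
      (≈-reflexive (cong +_ (value-cong L (λ i → cong bit (trans (h (quotient {N} N i) (remainder {N} N i))
        (cong (ripple (flat a) (flat b) false) (combine-remQuot {N} N i)))))))
      (value-add L (flat a) (flat b))

  -- Only the residue is specified, so the rules for the operations are free of size conditions.
  record Denotes {Γ Δ} (φ : Num Γ Δ) (e : All ⟦_⟧ Γ) (ρ : All RelVal Δ) (F : Matrix n) : Set where
    constructor denotes
    field at : ∀ x y → number (digits φ e ρ x y) ≈ F x y [ W ]

  digits-carryF : ∀ {Γ Δ} (φ ψ : Num Γ Δ) e ρ x y q₁ q₂ →
    digits (carryF φ ψ) e ρ x y q₁ q₂ ≡ carry (flat (digits φ e ρ x y)) (flat (digits ψ e ρ x y)) false (combine q₁ q₂)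
  digits-carryF {Γ} φ ψ e ρ x y q₁ q₂ = reflects-≡ direct (reflects-flat-carry (digits φ e ρ x y) (digits ψ e ρ x y) q₁ q₂)
    where
    E : All ⟦_⟧ (ν ∷ ν ∷ ι ∷ ι ∷ Γ)
    E = q₁ ∷ q₂ ∷ x ∷ y ∷ e
    Er : Fin N → Fin N → All ⟦_⟧ (ν ∷ ν ∷ ν ∷ ν ∷ ι ∷ ι ∷ Γ)
    Er r₁ r₂ = r₂ ∷ r₁ ∷ E
    Eu : (r₁ r₂ u₁ u₂ : Fin N) → All ⟦_⟧ (ν ∷ ν ∷ ν ∷ ν ∷ ν ∷ ν ∷ ι ∷ ι ∷ Γ)
    Eu r₁ r₂ u₁ u₂ = u₂ ∷ u₁ ∷ Er r₁ r₂
    at : Fin N → Fin N → All ⟦_⟧ (ν ∷ ν ∷ ι ∷ ι ∷ Γ)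
    at p₁ p₂ = p₁ ∷ p₂ ∷ x ∷ y ∷ e
    generated : ∀ r₁ r₂ → Agree genRen (at r₁ r₂) (Er r₁ r₂)
    generated r₁ r₂ = agree λ { v0 → refl ; v1 → refl ; (there (there v)) → refl }
    propagated : ∀ r₁ r₂ u₁ u₂ → Agree propRen (at u₁ u₂) (Eu r₁ r₂ u₁ u₂)
    propagated r₁ r₂ u₁ u₂ = agree λ { v0 → refl ; v1 → refl ; (there (there v)) → refl }
    atR : ∀ χ r₁ r₂ → Reflects (eval (ren genRen id∈ χ) (Er r₁ r₂) ρ) (digits χ e ρ x y r₁ r₂ ≡ true)
    atR χ r₁ r₂ = subst (λ b → Reflects b (digits χ e ρ x y r₁ r₂ ≡ true))
      (sym (eval-ren genRen id∈ (generated r₁ r₂) ragree-id χ)) reflects-id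
    atU : ∀ χ r₁ r₂ u₁ u₂ → Reflects (eval (ren propRen id∈ χ) (Eu r₁ r₂ u₁ u₂) ρ) (digits χ e ρ x y u₁ u₂ ≡ true)
    atU χ r₁ r₂ u₁ u₂ = subst (λ b → Reflects b (digits χ e ρ x y u₁ u₂ ≡ true))
      (sym (eval-ren propRen id∈ (propagated r₁ r₂ u₁ u₂) ragree-id χ)) reflects-id
    direct : Reflects (digits (carryF φ ψ) e ρ x y q₁ q₂) (LexGenerates (digits φ e ρ x y) (digits ψ e ρ x y) q₁ q₂)
    direct = reflects-any N λ r₁ → reflects-any N λ r₂ → reflects-∧ (reflects-lexF v1 v0 v2 v3 (Er r₁ r₂) ρ)
      (reflects-∧ (reflects-∧ (atR φ r₁ r₂) (atR ψ r₁ r₂))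
        (reflects-all N λ u₁ → reflects-all N λ u₂ → reflects-→
          (reflects-∧ (reflects-lexF v3 v2 v1 v0 (Eu r₁ r₂ u₁ u₂) ρ) (reflects-lexF v1 v0 v4 v5 (Eu r₁ r₂ u₁ u₂) ρ))
          (reflects-∨ (atU φ r₁ r₂ u₁ u₂) (atU ψ r₁ r₂ u₁ u₂))))

  opaque
    unfolding addM

    eval-addM : ∀ {Γ Δ} (φ ψ : Num Γ Δ) e ρ → eval (addM φ ψ) e ρ ≡ eval (xorF (xorF φ ψ) (carryF φ ψ)) e ρ
    eval-addM φ ψ e ρ = refl

  number-addM : ∀ {Γ Δ} (φ ψ : Num Γ Δ) e ρ x y → number (digits (addM φ ψ) e ρ x y)
    ≈ number (digits φ e ρ x y) + number (digits ψ e ρ x y) [ W ]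
  number-addM {Γ} φ ψ e ρ x y = number-ripple (digits φ e ρ x y) (digits ψ e ρ x y) each
    where
    each : ∀ p₁ p₂ → digits (addM φ ψ) e ρ x y p₁ p₂ ≡
           ripple (flat (digits φ e ρ x y)) (flat (digits ψ e ρ x y)) false (combine p₁ p₂)
    each p₁ p₂ = trans (eval-addM φ ψ E ρ) (trans (eval-xorF (xorF φ ψ) (carryF φ ψ) E ρ)
      (cong₂ _xor_ (trans (eval-xorF φ ψ E ρ)
                     (sym (cong₂ _xor_ (flat-combine (digits φ e ρ x y) p₁ p₂) (flat-combine (digits ψ e ρ x y) p₁ p₂))))
                   (digits-carryF φ ψ e ρ x y p₁ p₂)))
      where
      E : All ⟦_⟧ (ν ∷ ν ∷ ι ∷ ι ∷ Γ)
      E = p₁ ∷ p₂ ∷ x ∷ y ∷ e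

  number-subM : ∀ {Γ Δ} (φ ψ : Num Γ Δ) e ρ x y → number (digits (subM φ ψ) e ρ x y)
    ≈ number (digits φ e ρ x y) - number (digits ψ e ρ x y) [ W ]
  number-subM φ ψ e ρ x y = ≈-trans (number-not (digits (addM (neg φ) ψ) e ρ x y))
    (≈-trans (≈-+ (≈-reflexive {a = - (+ 1)} refl) (≈-neg (≈-trans (number-addM (neg φ) ψ e ρ x y)
                (≈-+ (number-not (digits φ e ρ x y)) (≈-reflexive {a = number (digits ψ e ρ x y)} refl)))))
             (≈-reflexive (cancel (number (digits φ e ρ x y)) (number (digits ψ e ρ x y)))))
    where
    cancel : ∀ a b → - (+ 1) + - ((- (+ 1) - a) + b) ≡ a - b
    cancel = solve-∀

  module _ {Γ Δ} {e : All ⟦_⟧ Γ} {ρ : All RelVal Δ} where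

    denotes-addM : ∀ {φ ψ F G} → Denotes φ e ρ F → Denotes ψ e ρ G → Denotes (addM φ ψ) e ρ (λ x y → F x y + G x y)
    denotes-addM {φ} {ψ} (denotes f) (denotes g) = denotes λ x y → ≈-trans (number-addM φ ψ e ρ x y) (≈-+ (f x y) (g x y))

    denotes-subM : ∀ {φ ψ F G} → Denotes φ e ρ F → Denotes ψ e ρ G → Denotes (subM φ ψ) e ρ (λ x y → F x y - G x y)
    denotes-subM {φ} {ψ} (denotes f) (denotes g) = denotes λ x y → ≈-trans (number-subM φ ψ e ρ x y) (≈-+ (f x y) (≈-neg (g x y)))

  number-and : ∀ b {a v} → number a ≈ v [ W ] → number (λ p q → b ∧ a p q) ≈ (if b then v else + 0) [ W ]
  number-and true  h = h
  number-and false h = ≈-reflexive (number-false (λ p q → refl))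

  env : ∀ {Γ} → All ⟦_⟧ Γ → Fin n → Fin n → Fin N → Fin N → All ⟦_⟧ (ν ∷ ν ∷ ι ∷ ι ∷ Γ)
  env e x y p₁ p₂ = p₁ ∷ p₂ ∷ x ∷ y ∷ e

  denotes-falseF : ∀ {Γ Δ} {e : All ⟦_⟧ Γ} {ρ : All RelVal Δ} → Denotes falseF e ρ (λ _ _ → + 0)
  denotes-falseF {e = e} {ρ} = denotes λ x y → ≈-reflexive (number-false (λ p₁ p₂ → falseF-false (env e x y p₁ p₂) ρ))

  denotes-condM : ∀ {Γ Δ c φ F} {e : All ⟦_⟧ Γ} {ρ : All RelVal Δ} (b : Fin n → Fin n → Bool) →
    (∀ x y → eval c (x ∷ y ∷ e) ρ ≡ b x y) →
    Denotes φ e ρ F → Denotes (condM c φ) e ρ (λ x y → if b x y then F x y else + 0)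
  denotes-condM {Γ} {c = c} {φ} {e = e} {ρ} b h (denotes f) = denotes λ x y → ≈-trans
    (≈-reflexive (number-cong (λ p₁ p₂ → cong (_∧ digits φ e ρ x y p₁ p₂)
      (trans (eval-ren (λ v → there (there v)) id∈ (outer x y p₁ p₂) ragree-id c) (h x y)))))
    (number-and (b x y) (f x y))
    where
    outer : ∀ x y p₁ p₂ → Agree {ι ∷ ι ∷ Γ} (λ v → there (there v)) (x ∷ y ∷ e) (env e x y p₁ p₂)
    outer x y p₁ p₂ = agree λ v → refl

-- Semantics of loops

≡false : ∀ {b} → ¬ (b ≡ true) → b ≡ false
≡false {true}  h = ⊥-elim (h refl)
≡false {false} h = refl

anyFin-unique : ∀ m {f : Fin m → Bool} c → (∀ i → i ≢ c → f i ≡ false) → anyFin m f ≡ f c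
anyFin-unique m {f} c h = reflects-≡ (reflects-any m {P = λ i → f i ≡ true} (λ i → reflects-id))
  (reflects (λ e → c , e) λ (i , e) → at i e)
  where
  at : ∀ i → f i ≡ true → f c ≡ true
  at i e with i ≟ c
  ... | yes refl = e
  ... | no ne    = false≢true (trans (sym (h i ne)) e)

module LoopSemantics (𝔄 : MStr) where
  open MStr 𝔄
  open Sem 𝔄
  open Renaming 𝔄
  open Arithmetic 𝔄

  State : Set
  State = Fin n → Fin n → Fin N → Fin N → Bool

  -- The stages of a loop: S i t f is the state at time t with flag f after i stages, d₀ the initial state
  -- and d i t' the state computed at stage i from the state at time t'.
  module Stages
    (S : ℕ → Fin N → Fin N → State) (d₀ : State) (d : ℕ → Fin N → State)
    (S-zero : ∀ t f x y p q → S 0 t f x y p q ≡ false)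
    (S-suc : ∀ i t f x y p q → S (suc i) t f x y p q ≡ S i t f x y p q ∨ (not (S i t zeroV x y p q) ∧
      ((⌊ t ≟ zeroV ⌋ ∧ (⌊ f ≟ zeroV ⌋ ∨ d₀ x y p q)) ∨
       anyFin N (λ t' → (suc (toℕ t') ℕ.≡ᵇ toℕ t) ∧ (S i t' zeroV x y p q ∧ (⌊ f ≟ zeroV ⌋ ∨ d i t' x y p q))))))
    (F : ℕ → Matrix n)
    (F-zero : ∀ x y → number (d₀ x y) ≈ F 0 x y [ W ])
    (F-suc : ∀ i t → (∀ x y → number (S i t sizeβV x y) ≈ F (toℕ t) x y [ W ]) →
                     ∀ x y → number (d i t x y) ≈ F (suc (toℕ t)) x y [ W ])
    where

    after : ℕ → Fin N → Fin N → State
    after i t f x y p q = anyFin N (λ t' →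
      (suc (toℕ t') ℕ.≡ᵇ toℕ t) ∧ (S i t' zeroV x y p q ∧ (⌊ f ≟ zeroV ⌋ ∨ d i t' x y p q)))

    new : ℕ → Fin N → Fin N → State
    new i t f x y p q = (⌊ t ≟ zeroV ⌋ ∧ (⌊ f ≟ zeroV ⌋ ∨ d₀ x y p q)) ∨ after i t f x y p q

    fresh : ∀ i t f x y p q → S i t f x y p q ≡ false → S i t zeroV x y p q ≡ false → 
      S (suc i) t f x y p q ≡ new i t f x y p q
    fresh i t f x y p q e z = trans (S-suc i t f x y p q) (cong₂ (λ a b → a ∨ (not b ∧ new i t f x y p q)) e z)

    nonzero : ∀ t → 0 ℕ.< toℕ t → ⌊ t ≟ zeroV ⌋ ≡ false
    nonzero t lt = ≡false λ e → ℕ.<-irrefl (sym (trans (cong toℕ (to (reflects-⌊⌋ (t ≟ zeroV)) e)) toℕ-zeroV)) lt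

    -- Time t needs the mark of its predecessor from an earlier stage, so it enters at stage t + 1
    -- at the earliest.
    early : ∀ i t f x y p q → i ℕ.≤ toℕ t → S i t f x y p q ≡ false
    early zero    t f x y p q _  = S-zero t f x y p q
    early (suc i) t f x y p q lt = trans
      (fresh i t f x y p q (early i t f x y p q (ℕ.<⇒≤ lt)) (early i t zeroV x y p q (ℕ.<⇒≤ lt)))
      (cong₂ _∨_ (cong (_∧ (⌊ f ≟ zeroV ⌋ ∨ d₀ x y p q)) (nonzero t (ℕ.≤-trans (s≤s z≤n) lt))) (≡false none))
      where
      none : ¬ (after i t f x y p q ≡ true)
      none h with to (reflects-any N (λ t' → reflects-∧ (reflects-≡ᵇ (suc (toℕ t')) (toℕ t))
                        (reflects-∧ (reflects-id {S i t' zeroV x y p q}) (reflects-id {⌊ f ≟ zeroV ⌋ ∨ d i t' x y p q})))) h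
      ... | t' , s , m , _ = false≢true (trans (sym (early i t' zeroV x y p q
              (ℕ.≤-pred (ℕ.≤-trans lt (ℕ.≤-reflexive (sym s)))))) m)

    now-zero : ∀ t f x y p q → toℕ t ≡ 0 → S 1 t f x y p q ≡ ⌊ f ≟ zeroV ⌋ ∨ d₀ x y p q
    now-zero t f x y p q z = trans (fresh 0 t f x y p q (S-zero t f x y p q) (S-zero t zeroV x y p q))
      (trans (cong₂ (λ a b → (a ∧ (⌊ f ≟ zeroV ⌋ ∨ d₀ x y p q)) ∨ b)
               (from (reflects-⌊⌋ (t ≟ zeroV)) (toℕ-injective (trans z (sym toℕ-zeroV)))) (≡false none))
             (∨-identityʳ _))
      where
      none : ¬ (after 0 t f x y p q ≡ true)
      none h with to (reflects-any N (λ t' → reflects-∧ (reflects-≡ᵇ (suc (toℕ t')) (toℕ t))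
                        (reflects-id {S 0 t' zeroV x y p q ∧ (⌊ f ≟ zeroV ⌋ ∨ d 0 t' x y p q)}))) h
      ... | t' , s , _ with trans s z
      ...   | ()

    -- At stage t + 1 the time t is still unmarked, and the existential quantifier has the
    -- predecessor as its only possible witness.
    now-suc : ∀ i t t' f x y p q → toℕ t ≡ i → toℕ t ≡ suc (toℕ t') → S i t' zeroV x y p q ≡ true →
      S (suc i) t f x y p q ≡ ⌊ f ≟ zeroV ⌋ ∨ d i t' x y p q
    now-suc i t t' f x y p q ti tt' m = trans
      (fresh i t f x y p q (early i t f x y p q (ℕ.≤-reflexive (sym ti))) (early i t zeroV x y p q (ℕ.≤-reflexive (sym ti))))
      (trans (cong₂ (λ a b → (a ∧ (⌊ f ≟ zeroV ⌋ ∨ d₀ x y p q)) ∨ b)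
               (nonzero t (ℕ.≤-trans (s≤s z≤n) (ℕ.≤-reflexive (sym tt'))))
               (anyFin-unique N t' other))
             (cong₂ (λ a b → a ∧ (b ∧ (⌊ f ≟ zeroV ⌋ ∨ d i t' x y p q)))
               (from (reflects-≡ᵇ (suc (toℕ t')) (toℕ t)) (sym tt')) m))
      where
      other : ∀ u → u ≢ t' → (suc (toℕ u) ℕ.≡ᵇ toℕ t) ∧ (S i u zeroV x y p q ∧ (⌊ f ≟ zeroV ⌋ ∨ d i u x y p q)) ≡ false
      other u ne = cong (_∧ (S i u zeroV x y p q ∧ (⌊ f ≟ zeroV ⌋ ∨ d i u x y p q))) (≡false λ e → ne (toℕ-injective (ℕ.suc-injective
        (trans (to (reflects-≡ᵇ (suc (toℕ u)) (toℕ t)) e) tt'))))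

    pred : ∀ t i → toℕ t ≡ suc i → Σ (Fin N) λ t' → toℕ t' ≡ i
    pred t i e = fromℕ< {i} lt , toℕ-fromℕ< lt
      where
      lt : i ℕ.< N
      lt = ℕ.<-trans (ℕ.≤-reflexive (sym e)) (toℕ<n t)

    mark : ∀ i t x y p q → toℕ t ℕ.< i → S i t zeroV x y p q ≡ true
    mark (suc i) t x y p q lt with ℕ.m≤n⇒m<n∨m≡n (ℕ.≤-pred lt)
    ... | inj₁ old = trans (S-suc i t zeroV x y p q) (cong (_∨ (not (S i t zeroV x y p q) ∧ new i t zeroV x y p q)) (mark i t x y p q old))
    mark (suc zero) t x y p q lt | inj₂ e =
      trans (now-zero t zeroV x y p q e) (cong (_∨ d₀ x y p q) (≟-refl zeroV))
    mark (suc (suc i)) t x y p q lt | inj₂ e =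
      let t' , e' = pred t i e in trans (now-suc (suc i) t t' zeroV x y p q e (trans e (cong suc (sym e')))
                             (mark (suc i) t' x y p q (ℕ.≤-reflexive (cong suc e'))))
                          (cong (_∨ d (suc i) t' x y p q) (≟-refl zeroV))

    -- Once t is marked, the guard blocks additions for all flags.
    old-state : ∀ i t f x y p q → toℕ t ℕ.< i → S (suc i) t f x y p q ≡ S i t f x y p q
    old-state i t f x y p q lt = trans (S-suc i t f x y p q)
      (trans (cong (λ b → S i t f x y p q ∨ (not b ∧ new i t f x y p q)) (mark i t x y p q lt)) (∨-identityʳ _))

    flag-off : ⌊ sizeβV ≟ zeroV ⌋ ≡ false
    flag-off = ≡false λ e → sizeβV≢zeroV (to (reflects-⌊⌋ (sizeβV ≟ zeroV)) e)

    state : ∀ i t → toℕ t ℕ.< i → ∀ x y → number (S i t sizeβV x y) ≈ F (toℕ t) x y [ W ]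
    state (suc i) t lt x y with ℕ.m≤n⇒m<n∨m≡n (ℕ.≤-pred lt)
    ... | inj₁ old = ≈-trans (≈-reflexive (number-cong (λ p q → old-state i t sizeβV x y p q old))) (state i t old x y)
    state (suc zero) t lt x y | inj₂ e = ≈-trans
      (≈-reflexive (number-cong (λ p q → trans (now-zero t sizeβV x y p q e) (cong (_∨ d₀ x y p q) flag-off))))
      (subst (λ m → number (d₀ x y) ≈ F m x y [ W ]) (sym e) (F-zero x y))
    state (suc (suc i)) t lt x y | inj₂ e = let t' , e' = pred t i e in ≈-trans
      (≈-reflexive (number-cong (λ p q → trans
        (now-suc (suc i) t t' sizeβV x y p q e (trans e (cong suc (sym e'))) (mark (suc i) t' x y p q (ℕ.≤-reflexive (cong suc e'))))
        (cong (_∨ d (suc i) t' x y p q) flag-off))))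
      (subst (λ m → number (d (suc i) t' x y) ≈ F m x y [ W ]) (trans (cong suc e') (sym e))
        (F-suc (suc i) t' (state (suc i) t' (ℕ.≤-reflexive (cong suc e'))) x y))

  digits-loopM : ∀ {Γ Δ} (init : Num Γ Δ) step T e ρ x y p q → digits (loopM init step T) e ρ x y p q ≡
    stage Loop (loopBody init step) e ρ (tupleCount Loop) (evalT T (env e x y p q) ρ ∷ sizeβV ∷ p ∷ q ∷ x ∷ y ∷ [])
  digits-loopM {Γ} init step T e ρ x y p q = trans (unfolded (env e x y p q))
    (stage-ren skip id∈ (agree λ v → refl) ragree-id Loop (loopBody init step) (tupleCount Loop) _)
    where
    skip : Ren Γ (ν ∷ ν ∷ ι ∷ ι ∷ Γ)
    skip v = there (there (there (there v)))
    opaque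
      unfolding loopM
      unfolded : ∀ E → eval (loopM init step T) E ρ ≡
        stage Loop (ren (lifts Loop skip) (lift id∈) (loopBody init step)) E ρ (tupleCount Loop)
          (evalT T E ρ ∷ sizeβV ∷ lookup E v0 ∷ lookup E v1 ∷ lookup E v2 ∷ lookup E v3 ∷ [])
      unfolded E = refl

  eval-loopBody : ∀ {Γ Δ} (init : Num Γ Δ) step (e : All ⟦_⟧ Γ) (ρ : All RelVal Δ) (R : RelVal Loop) t f x y p q →
    eval (loopBody init step) (t ∷ f ∷ p ∷ q ∷ x ∷ y ∷ e) (R ∷ ρ) ≡
    not (R (t ∷ zeroV ∷ p ∷ q ∷ x ∷ y ∷ [])) ∧ ((⌊ t ≟ zeroV ⌋ ∧ (⌊ f ≟ zeroV ⌋ ∨ digits init e ρ x y p q)) ∨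
      anyFin N (λ t' → (suc (toℕ t') ℕ.≡ᵇ toℕ t) ∧ (R (t' ∷ zeroV ∷ p ∷ q ∷ x ∷ y ∷ []) ∧
        (⌊ f ≟ zeroV ⌋ ∨ digits step (t' ∷ e) (R ∷ ρ) x y p q))))
  eval-loopBody {Γ} {Δ} init step e ρ R t f x y p q = cong₂
    (λ a b → not (R (t ∷ zeroV ∷ p ∷ q ∷ x ∷ y ∷ [])) ∧ ((⌊ t ≟ zeroV ⌋ ∧ (⌊ f ≟ zeroV ⌋ ∨ a)) ∨ b))
    (eval-ren (λ v → there (there v)) there outer weaken init)
    (anyFin-cong N λ t' → cong (λ b → (suc (toℕ t') ℕ.≡ᵇ toℕ t) ∧ (R (t' ∷ zeroV ∷ p ∷ q ∷ x ∷ y ∷ []) ∧ (⌊ f ≟ zeroV ⌋ ∨ b)))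
      (eval-ren stepRen id∈ (inner t') (ragree-id {ρ = R ∷ ρ}) step))
    where
    E : All ⟦_⟧ (Loop ++ Γ)
    E = t ∷ f ∷ p ∷ q ∷ x ∷ y ∷ e
    outer : Agree {Γ' = Loop ++ Γ} (λ v → there (there v)) (env e x y p q) E
    outer = agree λ v → refl
    weaken : RAgree {Δ' = Loop ∷ Δ} there ρ (R ∷ ρ)
    weaken = ragree λ r ts → refl
    inner : ∀ t' → Agree {Γ' = ν ∷ Loop ++ Γ} stepRen (env (t' ∷ e) x y p q) (t' ∷ E)
    inner t' = agree λ { v0 → refl ; v1 → refl ; v2 → refl ; v3 → refl ; v4 → refl
                       ; (there (there (there (there (there v))))) → refl }

  -- The number of stages contains the factor n², which is positive because there is an index.
  toℕ<tupleCount : (t : Fin N) → Fin n → toℕ t ℕ.< tupleCount Loop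
  toℕ<tupleCount t x = ℕ.≤-trans (toℕ<n t) (big (n ℕ.* (n ℕ.* 1)) (positive x))
    where
    positive : Fin n → 1 ℕ.≤ n ℕ.* (n ℕ.* 1)
    positive x with n | x
    ... | suc m | _ = s≤s z≤n
    big : ∀ c → 1 ℕ.≤ c → N ℕ.≤ N ℕ.* (N ℕ.* (N ℕ.* (N ℕ.* c)))
    big (suc c) _ = ℕ.m≤m*n N (N ℕ.* (N ℕ.* (N ℕ.* suc c)))

  module _ {Γ Δ} {e : All ⟦_⟧ Γ} {ρ : All RelVal Δ} where

    -- The invariant rule for loops. The step must be correct for every relation `R` whose state at
    -- time t is correct, because the fixed point evaluates it on an intermediate stage.
    denotes-loopM : ∀ {init step T} (F : ℕ → Matrix n) (τ : Fin N) →
      Denotes init e ρ (F 0) →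
      (∀ (R : RelVal Loop) t → Denotes stateM (t ∷ e) (R ∷ ρ) (F (toℕ t)) → Denotes step (t ∷ e) (R ∷ ρ) (F (suc (toℕ t)))) →
      (∀ x y p q → evalT T (env e x y p q) ρ ≡ τ) →
      Denotes (loopM init step T) e ρ (F (toℕ τ))
    denotes-loopM {init} {step} {T} F τ (denotes F-zero) F-suc T≡τ = denotes λ x y → ≈-trans
      (≈-reflexive (number-cong (λ p q → trans (digits-loopM init step T e ρ x y p q)
        (cong (λ t → S (tupleCount Loop) t sizeβV x y p q) (T≡τ x y p q)))))
      (Stages.state S (digits init e ρ) (λ i t → digits step (t ∷ e) (rel-at i ∷ ρ))
        (λ t f x y p q → refl)
        (λ i t f x y p q → cong (S i t f x y p q ∨_) (eval-loopBody init step e ρ (rel-at i) t f x y p q))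
        F F-zero (λ i t st → Denotes.at (F-suc (rel-at i) t (denotes st)))
        (tupleCount Loop) τ (toℕ<tupleCount τ x) x y)
      where
      rel-at : ℕ → RelVal Loop
      rel-at = stage Loop (loopBody init step) e ρ
      S : ℕ → Fin N → Fin N → State
      S i t f x y p q = rel-at i (t ∷ f ∷ p ∷ q ∷ x ∷ y ∷ [])

-- The formula for the recursion

diagRen : ∀ {Γ} → Ren (ν ∷ ν ∷ ι ∷ ι ∷ Γ) (ν ∷ ν ∷ ι ∷ ι ∷ ι ∷ Γ)
diagRen v0 = v0
diagRen v1 = v1
diagRen v2 = v4
diagRen v3 = v4
diagRen (there (there (there (there v)))) = there (there (there (there (there v))))

factorRen : ∀ {Γ} → Ren (ν ∷ ν ∷ ι ∷ ι ∷ Γ) (ν ∷ ν ∷ ι ∷ ι ∷ ι ∷ ν ∷ Γ)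
factorRen v0 = v0
factorRen v1 = v1
factorRen v2 = v4
factorRen v3 = v3
factorRen (there (there (there (there v)))) = there (there (there (there (there (there v)))))

-- the digit of the (x , z) entry with exactly t more significant ones, where t is the time
digitF : ∀ {Γ Δ} → Formula (ν ∷ ν ∷ ι ∷ ι ∷ ι ∷ ν ∷ Γ) Δ
digitF = ex β (and (eq (count β (lessB (var v1) (var v0))) (var v6)) (bitM (var v3) (var v5) (var v0)))

-- Multiplying by a binary digit means selecting, so one digit of every entry of a row is handled by
-- one sum over z. The condition `sgn` separates the positive entries from the others, whose sum is
-- subtracted.
productM : ∀ {Γ Δ} → Formula (ν ∷ ν ∷ ι ∷ ι ∷ ι ∷ ν ∷ Γ) (Loop ∷ Δ) → Num Γ Δ → Num (ν ∷ Γ) (Loop ∷ Δ)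
productM sgn ψ = sumM (and (and digitF sgn) (ren factorRen there ψ))

-- Horner's rule on the binary digits of the entries of the given matrix
mulM : ∀ {Γ Δ} → Num Γ Δ → Num Γ Δ
mulM ψ = loopM falseF
  (addM (addM stateM stateM) (subM (productM (posM (var v2) (var v4)) ψ) (productM (neg (posM (var v2) (var v4))) ψ)))
  sizeβ

oneM : ∀ {Γ Δ} → Num Γ Δ
oneM = and (eq (var v2) (var v3)) (and (eq (var v0) zeroT) (eq (var v1) zeroT))

traceM : ∀ {Γ Δ} → Num Γ Δ → Num Γ Δ
traceM φ = sumM (ren diagRen id∈ φ)

iterateM : ∀ {Γ Δ} → Num (ν ∷ Γ) (Loop ∷ Δ)
iterateM = subM (subM (condM (eq (var v0) (var v1)) (traceM (mulM stateM))) (timesM (var v4) (mulM stateM))) (mulM stateM)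

imageM : Num (ν ∷ []) []
imageM = mulM (loopM oneM iterateM (var v4))

imageRen : Ren (ν ∷ ν ∷ ι ∷ ι ∷ ν ∷ []) (ν ∷ ν ∷ ι ∷ ν ∷ [])
imageRen v0 = v1
imageRen v1 = v0
imageRen v2 = v2
imageRen v3 = v2
imageRen v4 = v3

-- The first disjunct covers the empty matrix, whose determinant is 1 and for which no t has t + 1 =
-- n.
nonsingular : Sentence
nonsingular = or (neg (ex ι (eq (var v0) (var v0))))
  (ex ν (and (succN (var v0) sizeι) (ex ι (ex ν (ex ν (ren imageRen id∈ imageM))))))

-- Semantics of sums, traces and the unit matrix

countFin-< : ∀ m s → countFin m (λ i → s ℕ.<ᵇ toℕ i) ≡ m ∸ suc s
countFin-< zero    s       = refl
countFin-< (suc m) zero    = countFin-true m (λ i → refl)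
countFin-< (suc m) (suc s) = countFin-< m s

module Correctness (𝔄 : MStr) where
  open MStr 𝔄
  open Sem 𝔄
  open Renaming 𝔄
  open Arithmetic 𝔄
  open LoopSemantics 𝔄

  opaque
    unfolding number

    -- Digits here are arbitrary natural numbers: the numbers of digits 1 at each position, before
    -- any carrying.
    total : (Fin N → Fin N → ℕ) → ℤ
    total d = + value L (flat d)

    total-0 : ∀ (c : Fin N → Fin N → ℕ) → total (λ p q → 0 ⊓ c p q) ≡ + 0
    total-0 c = cong +_ (value-0 L (λ i → refl))

    -- Raising the cut-off from t to t + 1 adds 1 exactly at the positions with t < c, which is a
    -- number in ordinary binary digits.
    total-suc : ∀ t (c : Fin N → Fin N → ℕ) → total (λ p q → t ⊓ c p q) + number (λ p q → t ℕ.<ᵇ c p q) ≡ total (λ p q → suc t ⊓ c p q)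
    total-suc t c = cong +_ (trans
      (sym (value-+ L (λ i → t ⊓ flat {N} c i) (λ i → bit (t ℕ.<ᵇ flat {N} c i))))
      (value-cong L (λ i → grow t (flat {N} c i))))
      where
      grow : ∀ t c → t ⊓ c ℕ.+ bit (t ℕ.<ᵇ c) ≡ suc t ⊓ c
      grow zero    zero    = refl
      grow zero    (suc c) = refl
      grow (suc t) zero    = refl
      grow (suc t) (suc c) = cong suc (grow t c)

    total-count : ∀ m (a : Fin m → Fin N → Fin N → Bool) →
      total (λ p q → m ⊓ countFin m (λ z → a z p q)) ≡ sumℤ m (λ z → number (a z))
    total-count m a = trans (cong +_ (value-cong L (λ i → ℕ.m≥n⇒m⊓n≡n (countFin≤ m (λ z → flat {N} (a z) i)))))
      (value-count L m (λ z → flat {N} (a z)))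

    number-one : number (λ p q → ⌊ p ≟ zero ⌋ ∧ ⌊ q ≟ zero ⌋) ≡ + 1
    number-one = cong (λ v → + (1 ℕ.+ 2 ℕ.* v)) (value-0 _ λ i → cong bit (≡false (off i)))
      where
      off : ∀ i → ¬ (flat {N} (λ p q → ⌊ p ≟ zero ⌋ ∧ ⌊ q ≟ zero ⌋) (suc i) ≡ true)
      off i h with to (reflects-∧ (reflects-⌊⌋ (quotient {N} N (suc i) ≟ zero)) (reflects-⌊⌋ (remainder {N} N (suc i) ≟ zero))) h
      ... | e₁ , e₂ with trans (sym (combine-remQuot {N} N (suc i))) (cong₂ combine e₁ e₂)
      ...   | ()

    number≢0 : ∀ a → (∃ λ p → ∃ λ q → a p q ≡ true) → number a ≢ + 0
    number≢0 a (p , q , e) z with trans (cong bit (sym (trans (flat-combine a p q) e)))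
                                    (value≡0⇒ L {λ i → bit (flat {N} a i)} (ℤ.+-injective z) (combine p q))
    ... | ()

  number≢0⇒ : ∀ a → number a ≢ + 0 → ∃ λ p → ∃ λ q → a p q ≡ true
  number≢0⇒ a ne with anyFin N (λ p → anyFin N (a p)) in e
  ... | true  = to r e
    where
    r : Reflects (anyFin N (λ p → anyFin N (a p))) (∃ λ p → ∃ λ q → a p q ≡ true)
    r = reflects-any N λ p → reflects-any N λ q → reflects-id
  ... | false = ⊥-elim (ne (number-false λ p q → ≡false λ h → false≢true (trans (sym e) (from r (p , q , h)))))
    where
    r : Reflects (anyFin N (λ p → anyFin N (a p))) (∃ λ p → ∃ λ q → a p q ≡ true)
    r = reflects-any N λ p → reflects-any N λ q → reflects-id

  denotes-cong : ∀ {Γ Δ φ F G} {e : All ⟦_⟧ Γ} {ρ : All RelVal Δ} →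
    (∀ x y → F x y ≡ G x y) → Denotes φ e ρ F → Denotes φ e ρ G
  denotes-cong h (denotes f) = denotes λ x y → ≈-trans (f x y) (≈-reflexive (h x y))

  module _ {Γ Δ} {e : All ⟦_⟧ Γ} {ρ : All RelVal Δ} where

    denotes-wkNum : ∀ {φ F} (t : Fin N) (R : RelVal Loop) → Denotes φ e ρ F → Denotes (wkNum φ) (t ∷ e) (R ∷ ρ) F
    denotes-wkNum {φ} t R (denotes f) = denotes λ x y → ≈-trans (≈-reflexive (number-cong (λ p q →
      eval-ren (lifts (ν ∷ ν ∷ ι ∷ ι ∷ []) there) there (shift x y p q) weaken φ))) (f x y)
      where
      shift : ∀ x y p q → Agree (lifts {Γ' = ν ∷ Γ} (ν ∷ ν ∷ ι ∷ ι ∷ []) there) (env e x y p q) (env (t ∷ e) x y p q)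
      shift x y p q = agree λ { v0 → refl ; v1 → refl ; v2 → refl ; v3 → refl ; (there (there (there (there v)))) → refl }
      weaken : RAgree {Δ' = Loop ∷ Δ} there ρ (R ∷ ρ)
      weaken = ragree λ r ts → refl

    denotes-timesM : ∀ {T φ F} (τ : Fin N) → (∀ x y p q → evalT T (env e x y p q) ρ ≡ τ) →
      Denotes φ e ρ F → Denotes (timesM T φ) e ρ (λ x y → + toℕ τ * F x y)
    denotes-timesM {T} {φ} {F} τ T≡τ f = denotes-loopM (λ t x y → + t * F x y) τ
      (denotes-cong (λ x y → sym (ℤ.*-zeroˡ (F x y))) denotes-falseF)
      (λ R t st → denotes-cong (λ x y → step (+ toℕ t) (F x y))
        (denotes-addM st (denotes-wkNum t R f)))
      T≡τ
      where
      step : ∀ t a → t * a + a ≡ (+ 1 + t) * a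
      step = solve-∀

    denotes-sumM : ∀ {φ} {F : Fin n → Matrix n} → (∀ z → Denotes φ (z ∷ e) ρ (F z)) →
      Denotes (sumM φ) e ρ (λ x y → sumℤ n (λ z → F z x y))
    denotes-sumM {φ} {F} f = denotes λ x y → ≈-trans
      -- Invariant: after t rounds the count at each position has been added up to the cut-off t. No
      -- count exceeds n, so n rounds remove the cut-off.
      (Denotes.at (denotes-loopM (λ t x y → total (λ p q → t ⊓ c x y p q)) sizeιV
        (denotes-cong (λ x y → sym (total-0 (c x y))) denotes-falseF)
        (λ R t st → denotes-cong (λ x y → total-suc (toℕ t) (c x y))
          (denotes-addM st
            (denotes λ x y → ≈-reflexive (number-cong (below R t x y)))))
        (λ x y p q → refl)) x y)
      (≈-trans (≈-reflexive (trans (cong (λ m → total (λ p q → m ⊓ c x y p q)) toℕ-sizeιV)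
                                   (total-count n (λ z → digits φ (z ∷ e) ρ x y))))
               (≈-sum n (λ z → Denotes.at (f z) x y)))
      where
      c : Fin n → Fin n → Fin N → Fin N → ℕ
      c x y p q = countFin n (λ z → digits φ (z ∷ e) ρ x y p q)
      below : ∀ (R : RelVal Loop) t x y p q →
        digits (ltN (var v4) (count ι (ren countRen there φ))) (t ∷ e) (R ∷ ρ) x y p q ≡ (toℕ t ℕ.<ᵇ c x y p q)
      below R t x y p q = reflects-≡
        (reflects-ltN (var v4) (count ι (ren countRen there φ)) (env (t ∷ e) x y p q) (R ∷ ρ))
        (subst (λ m → Reflects (toℕ t ℕ.<ᵇ c x y p q) (toℕ t ℕ.< m)) (sym counted) (reflects-<ᵇ (toℕ t) (c x y p q)))
        where
        shift : ∀ z → Agree {Γ' = ι ∷ ν ∷ ν ∷ ι ∷ ι ∷ ν ∷ Γ} countRen (env (z ∷ e) x y p q) (z ∷ env (t ∷ e) x y p q)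
        shift z = agree λ { v0 → refl ; v1 → refl ; v2 → refl ; v3 → refl ; v4 → refl
                          ; (there (there (there (there (there v))))) → refl }
        weaken : RAgree {Δ' = Loop ∷ Δ} there ρ (R ∷ ρ)
        weaken = ragree λ r ts → refl
        counted : toℕ (toNum card (countFin n (λ z → eval (ren countRen there φ) (z ∷ env (t ∷ e) x y p q) (R ∷ ρ)))) ≡ c x y p q
        counted = trans (cong (toℕ ∘ toNum card) (countFin-cong n λ z → eval-ren countRen there (shift z) weaken φ))
          (toℕ-toNum card (c x y p q) (ℕ.≤-trans (countFin≤ n _) (ℕ.m≤m+n n (suc k))))

    denotes-traceM : ∀ {φ F} → Denotes φ e ρ F → Denotes (traceM φ) e ρ (λ _ _ → sumℤ n (λ z → F z z))
    denotes-traceM {φ} (denotes f) = denotes-sumM λ z → denotes λ x y → ≈-trans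
      (≈-reflexive (number-cong λ p q → eval-ren diagRen id∈ (diagonal z x y p q) ragree-id φ)) (f z z)
      where
      diagonal : ∀ z x y p q → Agree {Γ' = ν ∷ ν ∷ ι ∷ ι ∷ ι ∷ Γ} diagRen (env e z z p q) (env (z ∷ e) x y p q)
      diagonal z x y p q = agree λ { v0 → refl ; v1 → refl ; v2 → refl ; v3 → refl ; (there (there (there (there v)))) → refl }

    denotes-oneM : Denotes oneM e ρ (λ x y → if ⌊ x ≟ y ⌋ then + 1 else + 0)
    denotes-oneM = denotes λ x y → number-and ⌊ x ≟ y ⌋ (≈-reflexive (trans
      (cong (λ z → number (λ p q → ⌊ p ≟ z ⌋ ∧ ⌊ q ≟ z ⌋)) (toℕ-injective toℕ-zeroV)) number-one))

-- Correctness of the recursion modulo 2 ^ N²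

module Semantics (𝔄 : MStr) where
  open MStr 𝔄
  open Sem 𝔄
  open Renaming 𝔄
  open Arithmetic 𝔄
  open LoopSemantics 𝔄
  open Correctness 𝔄

  leading : ℕ → Fin n → Fin n → Bool
  leading t x z = anyFin (suc k) (λ s → (k ∸ toℕ s ℕ.≡ᵇ t) ∧ bitR x z s)

  horner : ℕ → Matrix n
  horner zero    x z = + 0
  horner (suc t) x z = (horner t x z + horner t x z) +
    ((if leading t x z ∧ posR x z then + 1 else + 0) - (if leading t x z ∧ not (posR x z) then + 1 else + 0))

  -- The matrix is decoded from the relations, so that the semantics of the formula can be stated
  -- for every structure, whether or not it comes from a matrix.
  entry : Matrix n
  entry = horner (suc k)

  open Leverrier entry using (iterate; image)

  eval-digitF : ∀ {Γ Δ} {e : All ⟦_⟧ Γ} {ρ : All RelVal Δ} (t : Fin N) (z x y : Fin n) p q →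
    eval digitF (env (z ∷ t ∷ e) x y p q) ρ ≡ leading (toℕ t) x z
  eval-digitF t z x y p q = anyFin-cong (suc k) λ s → cong (_∧ bitR x z s)
    (reflects-≡ (reflects-⌊⌋ (rank s ≟ t))
      (reflects (λ h → toℕ-injective (trans (toℕ-rank s) (to (reflects-≡ᵇ (k ∸ toℕ s) (toℕ t)) h)))
                (λ h → from (reflects-≡ᵇ (k ∸ toℕ s) (toℕ t)) (trans (sym (toℕ-rank s)) (cong toℕ h)))))
    where
    rank : Fin (suc k) → Fin N
    rank s = toNum card (countFin (suc k) (λ s' → toℕ s ℕ.<ᵇ toℕ s'))
    toℕ-rank : ∀ s → toℕ (rank s) ≡ k ∸ toℕ s
    toℕ-rank s = trans (toℕ-toNum card _ (ℕ.≤-trans (countFin≤ (suc k) (λ s' → toℕ s ℕ.<ᵇ toℕ s')) (ℕ.m≤n+m (suc k) n)))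
                       (countFin-< (suc k) (toℕ s))

  module _ {Γ Δ} {e : All ⟦_⟧ Γ} {ρ : All RelVal Δ} where

    denotes-productM : ∀ {sgn ψ X} (σ : Fin n → Fin n → Bool) (t : Fin N) (R : RelVal Loop) →
      (∀ z x y p q → eval sgn (env (z ∷ t ∷ e) x y p q) (R ∷ ρ) ≡ σ x z) → Denotes ψ e ρ X →
      Denotes (productM sgn ψ) (t ∷ e) (R ∷ ρ) (λ x y → sumℤ n (λ z → if leading (toℕ t) x z ∧ σ x z then X z y else + 0))
    denotes-productM {sgn} {ψ} {X} σ t R sgn≡σ (denotes f) = denotes-sumM {φ = and (and digitF sgn) (ren factorRen there ψ)} λ z → denotes λ x y → ≈-trans
      (≈-reflexive (number-cong λ p q → cong₂ _∧_
        (cong₂ _∧_ (eval-digitF {e = e} {ρ = R ∷ ρ} t z x y p q) (sgn≡σ z x y p q))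
        (eval-ren factorRen there (factor z x y p q) weaken ψ)))
      (number-and (leading (toℕ t) x z ∧ σ x z) (f z y))
      where
      factor : ∀ z x y p q → Agree {Γ' = ν ∷ ν ∷ ι ∷ ι ∷ ι ∷ ν ∷ Γ} factorRen (env e z y p q) (env (z ∷ t ∷ e) x y p q)
      factor z x y p q = agree λ { v0 → refl ; v1 → refl ; v2 → refl ; v3 → refl ; (there (there (there (there v)))) → refl }
      weaken : RAgree {Δ' = Loop ∷ Δ} there ρ (R ∷ ρ)
      weaken = ragree λ r ts → refl

    -- The invariant is the product with the matrix of leading parts `horner t`. By linearity,
    -- doubling and adding one digit commute with the sum over z, so one loop treats all entries of
    -- a row at once.
    denotes-mulM : ∀ {ψ X} → Denotes ψ e ρ X → Denotes (mulM ψ) e ρ (λ x y → sumℤ n (λ z → entry x z * X z y))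
    denotes-mulM {ψ} {X} f = subst (λ t → Denotes (mulM ψ) e ρ (λ x y → sumℤ n (λ z → horner t x z * X z y))) toℕ-sizeβV
      (denotes-loopM (λ t x y → sumℤ n (λ z → horner t x z * X z y)) sizeβV
        (denotes-cong (λ x y → sym (trans (sum-cong n (λ z → ℤ.*-zeroˡ (X z y))) (sum-0 n))) denotes-falseF)
        (λ R t st → denotes-cong (λ x y → step (toℕ t) x y)
          (denotes-addM (denotes-addM st st)
            (denotes-subM (denotes-productM {sgn = posM (var v2) (var v4)} {ψ = ψ} posR t R (λ z x y p q → refl) f)
                          (denotes-productM {sgn = neg (posM (var v2) (var v4))} {ψ = ψ} (λ x z → not (posR x z)) t R (λ z x y p q → refl) f))))
        (λ x y p q → refl))
      where
      step : ∀ t x y →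
        (sumℤ n (λ z → horner t x z * X z y) + sumℤ n (λ z → horner t x z * X z y)) +
        (sumℤ n (λ z → if leading t x z ∧ posR x z then X z y else + 0) -
         sumℤ n (λ z → if leading t x z ∧ not (posR x z) then X z y else + 0))
        ≡ sumℤ n (λ z → horner (suc t) x z * X z y)
      step t x y = sym (trans (sum-cong n (λ z → spread (leading t x z ∧ posR x z) (leading t x z ∧ not (posR x z)) (horner t x z) (X z y)))
        (trans (sum-+ n (λ z → h z + h z) (λ z → a z + - b z))
               (cong₂ _+_ (sum-+ n h h) (trans (sum-+ n a (λ z → - b z)) (cong (_+_ (sumℤ n a)) (sum-neg n b))))))
        where
        h a b : Fin n → ℤ
        h z = horner t x z * X z y
        a z = if leading t x z ∧ posR x z then X z y else + 0
        b z = if leading t x z ∧ not (posR x z) then X z y else + 0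
        select : ∀ c v → (if c then + 1 else + 0) * v ≡ (if c then v else + 0)
        select true  v = ℤ.*-identityˡ v
        select false v = ℤ.*-zeroˡ v
        distrib : ∀ g i j v → ((g + g) + (i - j)) * v ≡ (g * v + g * v) + (i * v - j * v)
        distrib = solve-∀
        spread : ∀ c d g v → ((g + g) + ((if c then + 1 else + 0) - (if d then + 1 else + 0))) * v ≡
          (g * v + g * v) + ((if c then v else + 0) + - (if d then v else + 0))
        spread c d g v = trans (distrib g (if c then + 1 else + 0) (if d then + 1 else + 0) v)
          (cong₂ (λ i j → (g * v + g * v) + (i - j)) (select c v) (select d v))

  denotes-iterateM : ∀ {Γ Δ} {e : All ⟦_⟧ Γ} {ρ : All RelVal Δ} (R : RelVal Loop) (t : Fin N) →
    Denotes stateM (t ∷ e) (R ∷ ρ) (iterate (toℕ t)) → Denotes iterateM (t ∷ e) (R ∷ ρ) (iterate (suc (toℕ t)))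
  denotes-iterateM R t st = denotes-subM
    (denotes-subM
      (denotes-condM (λ x y → ⌊ x ≟ y ⌋) (λ x y → refl) (denotes-traceM (denotes-mulM st)))
      (denotes-timesM t (λ x y p q → refl) (denotes-mulM st)))
    (denotes-mulM st)

  denotes-imageM : ∀ t → Denotes imageM (t ∷ []) [] (image (toℕ t))
  denotes-imageM t = denotes-mulM (denotes-loopM iterate t denotes-oneM denotes-iterateM (λ x y p q → refl))

  Accepts : Set
  Accepts = (¬ Fin n) ⊎ ∃ λ (t : Fin N) → suc (toℕ t) ≡ n × ∃ λ (x : Fin n) →
    ∃ λ p → ∃ λ q → digits imageM (t ∷ []) [] x x p q ≡ true

  reflects-nonsingular : Reflects (𝔄 ⊨ nonsingular) Accepts
  reflects-nonsingular = reflects-∨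
    (reflects (λ e x → to none e (x , refl)) (λ h → from none λ (x , _) → h x))
    (reflects-any N λ t → reflects-∧
      (subst (λ m → Reflects (suc (toℕ t) ℕ.≡ᵇ toℕ sizeιV) (suc (toℕ t) ≡ m)) toℕ-sizeιV (reflects-≡ᵇ (suc (toℕ t)) (toℕ sizeιV)))
      (reflects-any n λ x → reflects-any N λ p → reflects-any N λ q →
        subst (λ b → Reflects b (digits imageM (t ∷ []) [] x x p q ≡ true))
          (sym (eval-ren imageRen id∈ (arguments t x p q) ragree-id imageM)) reflects-id))
    where
    none : Reflects (eval {[]} {[]} (neg (ex ι (eq (var v0) (var v0)))) [] []) (¬ ∃ λ (x : Fin n) → x ≡ x)
    none = reflects-not (reflects-any n λ x → reflects-⌊⌋ (x ≟ x))
    arguments : ∀ t x p q → Agree {Γ' = ν ∷ ν ∷ ι ∷ ν ∷ []} imageRen (env (t ∷ []) x x p q) (q ∷ p ∷ x ∷ t ∷ [])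
    arguments t x p q = agree λ { v0 → refl ; v1 → refl ; v2 → refl ; v3 → refl ; v4 → refl }

  opaque
    unfolding number

    number<W : ∀ a → ∣ number a ∣ ℕ.< W
    number<W a = value-bit<2^ L (flat {N} a)

  module _ {t : Fin N} {x : Fin n} (small : ∣ image (toℕ t) x x ∣ ℕ.< W) where

    private
      lit : Fin N → Fin N → Bool
      lit = digits imageM (t ∷ []) [] x x

      congruent : number lit ≈ image (toℕ t) x x [ W ]
      congruent = Denotes.at (denotes-imageM t) x x

    digit⇒image≢0 : (∃ λ p → ∃ λ q → lit p q ≡ true) → image (toℕ t) x x ≢ + 0
    digit⇒image≢0 h z = number≢0 lit h (≈0⇒≡0 (number<W lit) (≈-trans congruent (≈-reflexive z)))

    -- Here the bound enters: a nonzero multiple of `W` would have no digit 1.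
    image≢0⇒digit : image (toℕ t) x x ≢ + 0 → ∃ λ p → ∃ λ q → lit p q ≡ true
    image≢0⇒digit ne = number≢0⇒ lit λ z → ne (≈0⇒≡0 small (≈-trans (≈-sym congruent) (≈-reflexive z)))

-- Reading a number from its leading digits

∸-step : ∀ {t K} → t ℕ.< K → K ∸ t ≡ suc (K ∸ suc t)
∸-step {zero}  {suc K} _       = refl
∸-step {suc t} {suc K} (s≤s h) = ∸-step h

-- the number formed by the t leading binary digits of m, read as a number with K digits
prefix : ℕ → ℕ → ℕ → ℕ
prefix K m zero    = 0
prefix K m (suc t) = prefix K m t ℕ.+ prefix K m t ℕ.+ bit (bitℕ m (K ∸ suc t))

-- Halving drops the lowest of the K + 1 digits, which is not among the first t.
prefix-half : ∀ K m t → t ℕ.≤ K → prefix (suc K) m t ≡ prefix K (m / 2) t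
prefix-half K m zero    _ = refl
prefix-half K m (suc t) h = cong₂ (λ a b → a ℕ.+ a ℕ.+ bit b) (prefix-half K m t (ℕ.<⇒≤ h)) (cong (bitℕ m) (∸-step h))

prefix-all : ∀ K m → m ℕ.< 2 ^ K → prefix K m K ≡ m
prefix-all zero    zero    _ = refl
prefix-all zero    (suc m) (s≤s ())
prefix-all (suc K) m h = begin
  prefix (suc K) m K ℕ.+ prefix (suc K) m K ℕ.+ bit (bitℕ m (K ∸ K))
    ≡⟨ cong₂ (λ a b → a ℕ.+ a ℕ.+ bit (bitℕ m b))
         (trans (prefix-half K m K ℕ.≤-refl) (prefix-all K (m / 2) (m<n*o⇒m/o<n (ℕ.<-≤-trans h (ℕ.≤-reflexive (ℕ.*-comm 2 (2 ^ K)))))))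
         (ℕ.n∸n≡0 K) ⟩
  m / 2 ℕ.+ m / 2 ℕ.+ bit (m % 2 ℕ.≡ᵇ 1)
    ≡⟨ cong (m / 2 ℕ.+ m / 2 ℕ.+_) (low (m % 2) (m%n<n m 2)) ⟩
  m / 2 ℕ.+ m / 2 ℕ.+ m % 2
    ≡⟨ rearrange (m / 2) (m % 2) ⟩
  m % 2 ℕ.+ m / 2 ℕ.* 2
    ≡⟨ m≡m%n+[m/n]*n m 2 ⟨
  m ∎
  where
  open ≡-Reasoning
  low : ∀ r → r ℕ.< 2 → bit (r ℕ.≡ᵇ 1) ≡ r
  low zero          _ = refl
  low (suc zero)    _ = refl
  low (suc (suc r)) (s≤s (s≤s ()))
  rearrange : ∀ q r → q ℕ.+ q ℕ.+ r ≡ r ℕ.+ q ℕ.* 2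
  rearrange = ℕRing.solve-∀

∣sum∣≤ : ∀ m {f : Fin m → ℤ} {c} → (∀ i → ∣ f i ∣ ℕ.≤ c) → ∣ sumℤ m f ∣ ℕ.≤ m ℕ.* c
∣sum∣≤ zero    h = z≤n
∣sum∣≤ (suc m) {f} h = ℕ.≤-trans (ℤ.∣i+j∣≤∣i∣+∣j∣ (f zero) (sumℤ m (f ∘ suc))) (ℕ.+-mono-≤ (h zero) (∣sum∣≤ m (h ∘ suc)))

-- The bound |image| < 2 ^ N² that makes residues modulo 2 ^ N² sufficient

square≤2^ : ∀ n → n ℕ.* n ℕ.≤ 2 ^ (2 ℕ.+ n)
square≤2^ n = ℕ.≤-trans (ℕ.m≤m+n (n ℕ.* n) (2 ℕ.* n ℕ.+ 3)) (go n)
  where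
  -- The added 2n + 3 makes the induction pass: twice n² + 2n + 3 exceeds its successor value by
  -- exactly n².
  go : ∀ n → n ℕ.* n ℕ.+ (2 ℕ.* n ℕ.+ 3) ℕ.≤ 2 ^ (2 ℕ.+ n)
  go zero    = ℕ.n≤1+n 3
  go (suc n) = ℕ.≤-trans (ℕ.≤-trans (ℕ.m≤m+n _ (n ℕ.* n)) (ℕ.≤-reflexive (double n))) (ℕ.*-monoʳ-≤ 2 (go n))
    where
    double : ∀ n → (suc n ℕ.* suc n ℕ.+ (2 ℕ.* suc n ℕ.+ 3)) ℕ.+ n ℕ.* n ≡ 2 ℕ.* (n ℕ.* n ℕ.+ (2 ℕ.* n ℕ.+ 3))
    double = ℕRing.solve-∀

module Bound {n : ℕ} (A : Matrix n) (b : ℕ) (A≤b : ∀ x y → ∣ A x y ∣ ℕ.≤ b) where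
  open Leverrier A using (iterate; image)

  -- The growth of the bound per round. If the entries of X_t are at most u, those of P_t are at
  -- most v = n b u; the trace adds n v and the scalar t + 1 adds (t + 1) v, together at most 2n v
  -- since t + 1 ≤ n.
  ratio : ℕ
  ratio = (n ℕ.+ n) ℕ.* (n ℕ.* b)

  ∣image∣≤ : ∀ t u → (∀ x y → ∣ iterate t x y ∣ ℕ.≤ u) → ∀ x y → ∣ image t x y ∣ ℕ.≤ n ℕ.* (b ℕ.* u)
  ∣image∣≤ t u h x y = ∣sum∣≤ n λ z → ℕ.≤-trans (ℕ.≤-reflexive (ℤ.abs-* (A x z) (iterate t z y))) (ℕ.*-mono-≤ (A≤b x z) (h z y))

  ∣iterate∣≤ : ∀ t → t ℕ.≤ n → ∀ x y → ∣ iterate t x y ∣ ℕ.≤ ratio ^ t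
  ∣iterate∣≤ zero    _ x y with ⌊ x ≟ y ⌋
  ... | true  = ℕ.≤-refl
  ... | false = z≤n
  ∣iterate∣≤ (suc t) h x y = ℕ.≤-trans (ℤ.∣i-j∣≤∣i∣+∣j∣ (trace - + t * image t x y) (image t x y))
    (ℕ.≤-trans (ℕ.+-mono-≤ (ℕ.≤-trans (ℤ.∣i-j∣≤∣i∣+∣j∣ trace (+ t * image t x y)) (ℕ.+-mono-≤ ∣trace∣≤ ∣multiple∣≤)) (image≤ x y))
      (ℕ.≤-trans (ℕ.≤-reflexive (collect n t v)) (ℕ.≤-trans (ℕ.*-monoˡ-≤ v (ℕ.+-monoʳ-≤ n h)) (ℕ.≤-reflexive (regroup n b (ratio ^ t))))))
    where
    v = n ℕ.* (b ℕ.* ratio ^ t)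
    image≤ = ∣image∣≤ t (ratio ^ t) (∣iterate∣≤ t (ℕ.<⇒≤ h))
    trace = if ⌊ x ≟ y ⌋ then sumℤ n (λ z → image t z z) else + 0
    ∣trace∣≤ : ∣ trace ∣ ℕ.≤ n ℕ.* v
    ∣trace∣≤ with ⌊ x ≟ y ⌋
    ... | true  = ∣sum∣≤ n (λ z → image≤ z z)
    ... | false = z≤n
    ∣multiple∣≤ : ∣ + t * image t x y ∣ ℕ.≤ t ℕ.* v
    ∣multiple∣≤ = ℕ.≤-trans (ℕ.≤-reflexive (ℤ.abs-* (+ t) (image t x y))) (ℕ.*-monoʳ-≤ t (image≤ x y))
    collect : ∀ n t v → n ℕ.* v ℕ.+ t ℕ.* v ℕ.+ v ≡ (n ℕ.+ suc t) ℕ.* v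
    collect = ℕRing.solve-∀
    regroup : ∀ n b r → (n ℕ.+ n) ℕ.* (n ℕ.* (b ℕ.* r)) ≡ (n ℕ.+ n) ℕ.* (n ℕ.* b) ℕ.* r
    regroup = ℕRing.solve-∀

  ∣image∣≤ratio^n : ∀ t → suc t ≡ n → ∀ x y → ∣ image t x y ∣ ℕ.≤ ratio ^ n
  ∣image∣≤ratio^n t refl x y = ℕ.≤-trans (∣image∣≤ t (ratio ^ t) (∣iterate∣≤ t (ℕ.n≤1+n t)) x y)
    (ℕ.≤-trans (ℕ.≤-reflexive (sym (ℕ.*-assoc n b (ratio ^ t))))
      (ℕ.*-monoˡ-≤ (ratio ^ t) (ℕ.m≤n*m (n ℕ.* b) (n ℕ.+ n))))

-- By n² ≤ 2 ^ (n + 2) the base is at most 2 ^ (n + k + 4), and (n + k + 4) n lies below N² = (n + k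
-- + 2)². A number of digits linear in N would not suffice for this estimate; its square does.
ratio^n<2^N² : ∀ n k → ((n ℕ.+ n) ℕ.* (n ℕ.* 2 ^ suc k)) ^ n ℕ.< 2 ^ (suc (n ℕ.+ suc k) ℕ.* suc (n ℕ.+ suc k))
ratio^n<2^N² n k = ℕ.≤-<-trans (ℕ.^-monoˡ-≤ n ratio≤) (ℕ.≤-<-trans
  (ℕ.≤-reflexive (ℕ.^-*-assoc 2 (4 ℕ.+ (n ℕ.+ k)) n))
  (ℕ.^-monoʳ-< 2 (s≤s (s≤s z≤n)) {(4 ℕ.+ (n ℕ.+ k)) ℕ.* n} (ℕ.≤-trans (ℕ.m≤m+n _ (n ℕ.* k ℕ.+ k ℕ.* k ℕ.+ 4 ℕ.* k ℕ.+ 3)) (ℕ.≤-reflexive (size n k)))))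
  where
  regroup : ∀ n p → (n ℕ.+ n) ℕ.* (n ℕ.* (2 ℕ.* p)) ≡ (4 ℕ.* p) ℕ.* (n ℕ.* n)
  regroup = ℕRing.solve-∀
  collect : ∀ a b → (4 ℕ.* b) ℕ.* (2 ℕ.* (2 ℕ.* a)) ≡ 2 ℕ.* (2 ℕ.* (2 ℕ.* (2 ℕ.* (a ℕ.* b))))
  collect = ℕRing.solve-∀
  ratio≤ : (n ℕ.+ n) ℕ.* (n ℕ.* 2 ^ suc k) ℕ.≤ 2 ^ (4 ℕ.+ (n ℕ.+ k))
  ratio≤ = ℕ.≤-trans (ℕ.≤-reflexive (regroup n (2 ^ k))) (ℕ.≤-trans (ℕ.*-monoʳ-≤ (4 ℕ.* 2 ^ k) (square≤2^ n))
    (ℕ.≤-reflexive (trans (collect (2 ^ n) (2 ^ k)) (cong (λ p → 2 ℕ.* (2 ℕ.* (2 ℕ.* (2 ℕ.* p)))) (sym (ℕ.^-distribˡ-+-* 2 n k))))))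
  size : ∀ n k → suc ((4 ℕ.+ (n ℕ.+ k)) ℕ.* n) ℕ.+ (n ℕ.* k ℕ.+ k ℕ.* k ℕ.+ 4 ℕ.* k ℕ.+ 3) ≡
         suc (n ℕ.+ suc k) ℕ.* suc (n ℕ.+ suc k)
  size = ℕRing.solve-∀

-- Structures that represent matrices

module _ (n k : ℕ) (M : Matrix n) (fits : Fits k M) where
  open Semantics (toStr n k M)
  open Arithmetic (toStr n k M) using (N; W)

  private
    signed : Fin n → Fin n → ℕ → ℤ
    signed x z m = if isPos (M x z) then + m else - + m

    leading≡bitℕ : ∀ t x z → t ℕ.< suc k → leading t x z ≡ bitℕ ∣ M x z ∣ (k ∸ t)
    leading≡bitℕ t x z t≤k = trans (anyFin-unique (suc k) s other)
      (trans (cong (_∧ bitℕ ∣ M x z ∣ (toℕ s)) (from (reflects-≡ᵇ (k ∸ toℕ s) t) k∸s)) (cong (bitℕ ∣ M x z ∣) toℕ-s))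
      where
      s : Fin (suc k)
      s = fromℕ< (s≤s (ℕ.m∸n≤m k t))
      toℕ-s : toℕ s ≡ k ∸ t
      toℕ-s = toℕ-fromℕ< _
      k∸s : k ∸ toℕ s ≡ t
      k∸s = trans (cong (k ∸_) toℕ-s) (ℕ.m∸[m∸n]≡n (ℕ.≤-pred t≤k))
      other : ∀ i → i ≢ s → (k ∸ toℕ i ℕ.≡ᵇ t) ∧ bitℕ ∣ M x z ∣ (toℕ i) ≡ false
      other i ne = cong (_∧ bitℕ ∣ M x z ∣ (toℕ i)) (≡false λ e → ne (toℕ-injective
        (trans (sym (ℕ.m∸[m∸n]≡n (ℕ.≤-pred (toℕ<n i))))
               (trans (cong (k ∸_) (to (reflects-≡ᵇ (k ∸ toℕ i) t) e)) (sym toℕ-s)))))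

    horner≡signed : ∀ t x z → t ℕ.≤ suc k → horner t x z ≡ signed x z (prefix (suc k) ∣ M x z ∣ t)
    horner≡signed zero    x z _ with isPos (M x z)
    ... | true  = refl
    ... | false = refl
    horner≡signed (suc t) x z h = trans
      (cong₂ (λ a b → (a + a) + ((if b ∧ isPos (M x z) then + 1 else + 0) - (if b ∧ not (isPos (M x z)) then + 1 else + 0)))
        (horner≡signed t x z (ℕ.<⇒≤ h)) (leading≡bitℕ t x z h))
      (next (isPos (M x z)) (bitℕ ∣ M x z ∣ (k ∸ t)) (prefix (suc k) ∣ M x z ∣ t))
      where
      next : ∀ s b m → ((if s then + m else - + m) + (if s then + m else - + m)) +
        ((if b ∧ s then + 1 else + 0) - (if b ∧ not s then + 1 else + 0)) ≡
        (if s then + (m ℕ.+ m ℕ.+ bit b) else - + (m ℕ.+ m ℕ.+ bit b))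
      next true  true  m = refl
      next true  false m = refl
      next false true  m = negated (+ m)
        where
        negated : ∀ a → (- a + - a) + (+ 0 - + 1) ≡ - (a + a + + 1)
        negated = solve-∀
      next false false m = negated (+ m)
        where
        negated : ∀ a → (- a + - a) + (+ 0 - + 0) ≡ - (a + a + + 0)
        negated = solve-∀

    entry≡M : ∀ x z → entry x z ≡ M x z
    entry≡M x z = trans (horner≡signed (suc k) x z ℕ.≤-refl)
      (trans (cong (signed x z) (prefix-all (suc k) ∣ M x z ∣ (fits x z))) (sign-abs (M x z)))
      where
      sign-abs : ∀ i → (if isPos i then + ∣ i ∣ else - + ∣ i ∣) ≡ i
      sign-abs (+ zero)   = refl
      sign-abs (+ suc m)  = refl
      sign-abs -[1+ m ]   = refl

  open Leverrier entry using (image)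

  image-small : ∀ t → suc t ≡ n → ∀ x → ∣ image t x x ∣ ℕ.< W
  image-small t e x = ℕ.≤-<-trans
    (Bound.∣image∣≤ratio^n entry (2 ^ suc k) (λ x y → ℕ.<⇒≤ (subst (λ i → ∣ i ∣ ℕ.< 2 ^ suc k) (sym (entry≡M x y)) (fits x y))) t e x x)
    (ratio^n<2^N² n k)

  det-entry : det n entry ≡ det n M
  det-entry = det-cong n entry≡M

accepts⇒det≢0 : ∀ n k M → Fits k M → Semantics.Accepts (toStr n k M) → det n M ≢ + 0
accepts⇒det≢0 zero    k M fits _ ()
accepts⇒det≢0 (suc m) k M fits (inj₁ empty) = ⊥-elim (empty zero)
accepts⇒det≢0 (suc m) k M fits (inj₂ (t , e , x , digit)) z =
  image≢0⇒det≢0 entry x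
    (subst (λ j → Leverrier.image entry j x x ≢ + 0) (ℕ.suc-injective e)
      (digit⇒image≢0 {t} {x} (image-small (suc m) k M fits (toℕ t) e x) digit))
    (trans (det-entry (suc m) k M fits) z)
  where open Semantics (toStr (suc m) k M)

det≢0⇒accepts : ∀ n k M → Fits k M → det n M ≢ + 0 → Semantics.Accepts (toStr n k M)
det≢0⇒accepts zero    k M fits ne = inj₁ λ ()
det≢0⇒accepts (suc m) k M fits ne = inj₂ (t , cong suc toℕ-t , zero ,
  image≢0⇒digit {t} {zero} (image-small (suc m) k M fits (toℕ t) (cong suc toℕ-t) zero)
    (subst (λ j → Leverrier.image entry j zero zero ≢ + 0) (sym toℕ-t)
      (det≢0⇒image≢0 entry (λ z → ne (trans (sym (det-entry (suc m) k M fits)) z)))))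
  where
  open Semantics (toStr (suc m) k M)
  m<N : m ℕ.< suc (suc m ℕ.+ suc k)
  m<N = s≤s (ℕ.≤-trans (ℕ.n≤1+n m) (ℕ.m≤m+n (suc m) (suc k)))
  t : Fin (suc (suc m ℕ.+ suc k))
  t = fromℕ< m<N
  toℕ-t : toℕ t ≡ m
  toℕ-t = toℕ-fromℕ< m<N

mainTheorem12 : Σ Sentence (λ φ → (n k : ℕ) (M : Matrix n) → Fits k M →
    ((toStr n k M ⊨ φ) ≡ true → det n M ≢ + 0) × (det n M ≢ + 0 → (toStr n k M ⊨ φ) ≡ true))
mainTheorem12 = nonsingular , λ n k M fits →
  (λ e → accepts⇒det≢0 n k M fits (to (Semantics.reflects-nonsingular (toStr n k M)) e)) ,
  (λ ne → from (Semantics.reflects-nonsingular (toStr n k M)) (det≢0⇒accepts n k M fits ne))
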